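{- Let $\tau\in\{123,321\}\subset S_3$ and let $l\ge2$ be fixed. Let $C_j=\frac1{j+1}\binom{2j}{j}$, $j\ge0$, denote the $j$th Catalan number. (i) For every fixed integer $k\ge1$, $$\lim_{n\to\infty}P_n^{\mathrm{av}(\tau)}(A^{(n)}_{l;k})=\lim_{n\to\infty}P_n^{\mathrm{av}(\tau)}(A^{(n)}_{l;n+2-k-l})=\frac1{4^{l-1}}+\frac{C_{k-1}(C_l-1)}{4^{k+l-1}}.$$ (ii) If $\{k_n\}$ is a sequence of integers with $1\le k_n\le n-l+1$ and $\lim_{n\to\infty}k_n=\lim_{n\to\infty}(n-k_n)=\infty$, then $$\lim_{n\to\infty}P_n^{\mathrm{av}(\tau)}(A^{(n)}_{l;k_n})=\frac1{4^{l-1}}.$$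
   Context: $S_n$ is the set of permutations of $[n]=\{1,\dots,n\}$, written $\sigma=\sigma_1\sigma_2\cdots\sigma_n$. For $l\in\{2,\dots,n-1\}$ and $k\ge1$ with $k+l-1\le n$, $A^{(n)}_{l;k}\subset S_n$ is the set of $\sigma\in S_n$ for which there exists $a$ with $\{k,k+1,\dots,k+l-1\}=\{\sigma_a,\sigma_{a+1},\dots,\sigma_{a+l-1}\}$. For $\tau\in S_m$ with $2\le m\le n$, $\sigma\in S_n$ contains $\tau$ as a pattern if there are indices $1\le i_1<\cdots<i_m\le n$ such that for all $1\le j,j'\le m$, $\sigma_{i_j}<\sigma_{i_{j'}}$ if and only if $\tau_j<\tau_{j'}$; otherwise $\sigma$ avoids $\tau$. $S_n(\tau)$ is the set of $\sigma\in S_n$ avoiding $\tau$; if $n<m$, $S_n(\tau)=S_n$. $P_n^{\mathrm{av}(\tau)}$ is the uniform probability measure on $S_n(\tau)$, so $P_n^{\mathrm{av}(\tau)}(A)=|A\cap S_n(\tau)|/|S_n(\tau)|$ for $A\subset S_n$. -}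

module Defs where

open import Level using (Level)
open import Data.Nat as ℕ using (ℕ; zero; suc; NonZero; NonTrivial)
import Data.Nat.Properties as ℕₚ
open import Data.Nat.Combinatorics using (_C_)
open import Data.Integer using (+_)
open import Data.Rational using (ℚ; 0ℚ; _/_; _-_; ∣_∣) renaming (_<_ to _<ℚ_)
open import Data.Fin as Fin using (Fin; toℕ; opposite)
import Data.Fin.Properties as Finₚ
open import Data.List using (List; []; _∷_; length; filter; allFin; cartesianProductWith)
open import Data.List.Membership.Propositional using (_∈_; find; lose)
open import Data.List.Membership.Propositional.Properties
  using (∈-allFin; ∈-cartesianProductWith⁺; ∈-filter⁺)
open import Data.List.Relation.Unary.Any using (here; there; any?)
open import Data.Vec as Vec using (Vec; lookup; tabulate)
open import Data.Vec.Properties using (lookup∘tabulate)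
open import Data.Product using (Σ; ∃; _×_; _,_)
open import Function using (_⇔_; mk⇔)
open import Function.Bundles using (module Equivalence)
open import Function.Consequences.Propositional
  using (strictlySurjective⇒surjective; surjective⇒strictlySurjective)
open import Function.Definitions using (Bijective; Injective; Surjective)
open import Relation.Nullary using (¬_; Dec; yes; no; ¬?; _×-dec_; _→-dec_)
open import Relation.Nullary.Decidable using (map′)
open import Relation.Unary using (Pred; Decidable; _≐_)
open import Relation.Binary.PropositionalEquality
  using (_≡_; refl; sym; trans; cong; subst₂)

private
  variable
    a p q : Level
    m n : ℕ

  _⇔-dec_ : {P : Set p} {Q : Set q} → Dec P → Dec Q → Dec (P ⇔ Q)
  P? ⇔-dec Q? = map′ (λ (f , g) → mk⇔ f g)
                     (λ e → Equivalence.to e , Equivalence.from e)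
                     ((P? →-dec Q?) ×-dec (Q? →-dec P?))

  ≐-dec : {P : Pred (Fin n) p} {Q : Pred (Fin n) q} →
          Decidable P → Decidable Q → Dec (P ≐ Q)
  ≐-dec P? Q? =
    map′ (λ f → (λ {v} → Equivalence.to (f v)) , (λ {v} → Equivalence.from (f v)))
         (λ (f , g) v → mk⇔ f g)
         (Finₚ.all? (λ v → P? v ⇔-dec Q? v))

-- Words σ₁σ₂⋯σₙ over [n], with [n] represented by Fin n.
Word : ℕ → Set
Word n = Vec (Fin n) n

-- The element of {1, …, n} that an element of Fin n stands for.
⟦_⟧ : Fin n → ℕ
⟦ i ⟧ = suc (toℕ i)

-- Every vector of Vec (Fin n) m, listed exactly once.
vectors : ∀ m n → List (Vec (Fin n) m)
vectors zero    n = Vec.[] ∷ []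
vectors (suc m) n = cartesianProductWith Vec._∷_ (allFin n) (vectors m n)

∈-vectors : (v : Vec (Fin n) m) → v ∈ vectors m n
∈-vectors Vec.[]       = here refl
∈-vectors (i Vec.∷ is) = ∈-cartesianProductWith⁺ Vec._∷_ (∈-allFin i) (∈-vectors is)

private
  anyVector? : {P : Pred (Vec (Fin n) m) p} → Decidable P → Dec (∃ P)
  anyVector? P? = map′ (λ any → let v , _ , Pv = find any in v , Pv)
                       (λ (v , Pv) → lose (∈-vectors v) Pv)
                       (any? P? (vectors _ _))

IsPermutation : Pred (Word n) _
IsPermutation σ = Bijective _≡_ _≡_ (lookup σ)

isPermutation? : Decidable (IsPermutation {n})
isPermutation? σ = injective? ×-dec surjective?
  where
  injective? : Dec (Injective _≡_ _≡_ (lookup σ))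
  injective? = map′ (λ f {x} {y} → f x y) (λ f x y → f {x} {y})
    (Finₚ.all? λ x → Finₚ.all? λ y →
      (lookup σ x Finₚ.≟ lookup σ y) →-dec (x Finₚ.≟ y))
  surjective? : Dec (Surjective _≡_ _≡_ (lookup σ))
  surjective? = map′ strictlySurjective⇒surjective surjective⇒strictlySurjective
    (Finₚ.all? λ y → Finₚ.any? λ x → lookup σ x Finₚ.≟ y)

permutations : ∀ n → List (Word n)
permutations n = filter isPermutation? (vectors n n)

Increasing : Pred (Vec (Fin n) m) _
Increasing is = ∀ j j′ → j Fin.< j′ → lookup is j Fin.< lookup is j′

Contains : Word m → Pred (Word n) _
Contains {m} {n} τ σ = Σ (Vec (Fin n) m) λ is → Increasing is ×
  (∀ j j′ → lookup σ (lookup is j) Fin.< lookup σ (lookup is j′)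
          ⇔ lookup τ j Fin.< lookup τ j′)

contains? : (τ : Word m) → Decidable (Contains {m} {n} τ)
contains? τ σ = anyVector? λ is →
  (Finₚ.all? λ j → Finₚ.all? λ j′ →
    (j Finₚ.<? j′) →-dec (lookup is j Finₚ.<? lookup is j′))
  ×-dec
  (Finₚ.all? λ j → Finₚ.all? λ j′ →
    (lookup σ (lookup is j) Finₚ.<? lookup σ (lookup is j′))
    ⇔-dec (lookup τ j Finₚ.<? lookup τ j′))

Avoids : Word m → Pred (Word n) _
Avoids τ σ = ¬ Contains τ σ

avoids? : (τ : Word m) → Decidable (Avoids {m} {n} τ)
avoids? τ σ = ¬? (contains? τ σ)

-- Sₙ(τ)
avoiders : Word m → ∀ n → List (Word n)
avoiders τ n = filter (avoids? τ) (permutations n)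

private
  identity reversal : ∀ n → Word n
  identity n = tabulate (λ i → i)
  reversal n = tabulate opposite

  identity-lookup : (i : Fin n) → lookup (identity n) i ≡ i
  identity-lookup = lookup∘tabulate (λ i → i)

  reversal-lookup : (i : Fin n) → lookup (reversal n) i ≡ opposite i
  reversal-lookup = lookup∘tabulate opposite

  involution⇒bijective : (σ : Word n) (f : Fin n → Fin n) →
    (∀ i → lookup σ i ≡ f i) → (∀ i → f (f i) ≡ i) → IsPermutation σ
  involution⇒bijective σ f σ≗f ff =
    (λ {x} {y} eq → trans (sym (ff x)) (trans
      (cong f (trans (sym (σ≗f x)) (trans eq (σ≗f y)))) (ff y))) ,
    (λ y → f y , λ { refl → trans (σ≗f (f y)) (ff y) })

  identity-perm : ∀ n → IsPermutation (identity n)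
  identity-perm n = involution⇒bijective (identity n) (λ i → i) identity-lookup (λ _ → refl)

  reversal-perm : ∀ n → IsPermutation (reversal n)
  reversal-perm n =
    involution⇒bijective (reversal n) opposite reversal-lookup Finₚ.opposite-involutive

  opposite-anti : {i j : Fin n} → i Fin.< j → opposite j Fin.< opposite i
  opposite-anti {n} {i} {j} i<j = subst₂ ℕ._<_
    (sym (Finₚ.opposite-prop j)) (sym (Finₚ.opposite-prop i))
    (ℕₚ.∸-monoʳ-< (ℕ.s≤s i<j) (Finₚ.toℕ<n j))

  ∈⇒nonZero : {A : Set a} {x : A} {xs : List A} → x ∈ xs → NonZero (length xs)
  ∈⇒nonZero (here _)  = _
  ∈⇒nonZero (there _) = _

  avoider⇒nonZero : (τ : Word m) (σ : Word n) → IsPermutation σ → Avoids τ σ →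
                    NonZero (length (avoiders τ n))
  avoider⇒nonZero τ σ perm avoids =
    ∈⇒nonZero (∈-filter⁺ (avoids? τ) (∈-filter⁺ isPermutation? (∈-vectors σ) perm) avoids)

-- The identity avoids τ if τ₁ ≥ τ₂, and its reversal avoids τ if τ₁ < τ₂.
avoiders-nonZero : .{{NonTrivial m}} → (τ : Word m) → ∀ n → NonZero (length (avoiders τ n))
avoiders-nonZero {suc (suc m)} τ n = byCases (lookup τ first Finₚ.<? lookup τ second)
  where
  first second : Fin (suc (suc m))
  first  = Fin.zero
  second = Fin.suc Fin.zero

  byCases : Dec (lookup τ first Fin.< lookup τ second) → NonZero (length (avoiders τ n))
  byCases (no τ₁≮τ₂) =
    avoider⇒nonZero τ (identity n) (identity-perm n) λ (is , inc , iso) →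
      τ₁≮τ₂ (Equivalence.to (iso first second)
        (subst₂ Fin._<_ (sym (identity-lookup _)) (sym (identity-lookup _))
          (inc first second ℕₚ.0<1+n)))
  byCases (yes τ₁<τ₂) =
    avoider⇒nonZero τ (reversal n) (reversal-perm n) λ (is , inc , iso) →
      Finₚ.<-asym
        (subst₂ Fin._<_ (reversal-lookup _) (reversal-lookup _)
          (Equivalence.from (iso first second) τ₁<τ₂))
        (opposite-anti (inc first second ℕₚ.0<1+n))

-- Pₙ^{av(τ)}(A)
Pav : .{{NonTrivial m}} → (τ : Word m) {A : Pred (Word n) p} → Decidable A → ℚ
Pav {n = n} τ A? =
  (+ length (filter A? (avoiders τ n)) / length (avoiders τ n)) {{avoiders-nonZero τ n}}

-- The elements of [n] in {a, a+1, …, a+l-1}.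
Interval : (a l : ℕ) → Pred (Fin n) _
Interval a l i = a ℕ.≤ ⟦ i ⟧ × ⟦ i ⟧ ℕ.< a ℕ.+ l

interval? : ∀ a l → Decidable (Interval {n} a l)
interval? a l i = (a ℕₚ.≤? ⟦ i ⟧) ×-dec (⟦ i ⟧ ℕₚ.<? a ℕ.+ l)

-- {σ_a, …, σ_{a+l-1}}
Window : Word n → (a l : ℕ) → Pred (Fin n) _
Window σ a l v = ∃ λ i → Interval a l i × lookup σ i ≡ v

window? : (σ : Word n) → ∀ a l → Decidable (Window σ a l)
window? σ a l v = Finₚ.any? λ i → interval? a l i ×-dec (lookup σ i Finₚ.≟ v)

-- The condition defining A^{(n)}_{l;k}; only meaningful for 2 ≤ l < n, 1 ≤ k and k + l - 1 ≤ n.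
Clustered : (l k : ℕ) → Pred (Word n) _
Clustered {n} l k σ = Σ (Fin n) λ a →
  ⟦ a ⟧ ℕ.+ l ℕ.≤ suc n × Interval k l ≐ Window σ ⟦ a ⟧ l

clustered? : ∀ l k → Decidable (Clustered {n} l k)
clustered? {n} l k σ = Finₚ.any? λ a →
  (⟦ a ⟧ ℕ.+ l ℕₚ.≤? suc n) ×-dec ≐-dec (interval? k l) (window? σ ⟦ a ⟧ l)

pattern123 pattern321 : Word 3
pattern123 = Fin.zero Vec.∷ Fin.suc Fin.zero Vec.∷ Fin.suc (Fin.suc Fin.zero) Vec.∷ Vec.[]
pattern321 = Fin.suc (Fin.suc Fin.zero) Vec.∷ Fin.suc Fin.zero Vec.∷ Fin.zero Vec.∷ Vec.[]

catalan : ℕ → ℚ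
catalan j = + ((2 ℕ.* j) C j) / suc j

1/4^_ : ℕ → ℚ
1/4^ e = (+ 1 / (4 ℕ.^ e)) {{ℕₚ.m^n≢0 4 e}}

-- Since the limits below are rational, rational ε suffice.
_⟶_ : (ℕ → ℚ) → ℚ → Set
f ⟶ L = ∀ ε → 0ℚ <ℚ ε → ∃ λ N → ∀ n → N ℕ.≤ n → ∣ f n - L ∣ <ℚ ε

_⟶∞ : (ℕ → ℕ) → Set
f ⟶∞ = ∀ M → ∃ λ N → ∀ n → N ℕ.≤ n → M ℕ.≤ f n

infix 4 _⟶_ _⟶∞
infix 9 1/4^_

{-# OPTIONS --safe #-}
module Submission where

-- The values k, …, k+l-1 of a 123-avoiding permutation can be clustered in two ways. If they
-- decrease, contracting them to a single value is a bijection onto the 123-avoiding permutations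
-- of n-l+1 letters. If they contain an ascent, every larger value stands before and every smaller
-- value after the cluster, so the permutation is a skew sum of three 123-avoiding permutations, of
-- which the middle one is not the decreasing one. Hence exactly
--   C_{n-l+1} + C_{k-1} (C_l - 1) C_{n-k-l+1}
-- of the C_n permutations are clustered, an expression that is symmetric under k ↦ n+2-k-l. The
-- limits for fixed k follow from 4 C_n - C_{n+1} = 6 C_n / (n+2). If k and n-k tend to infinity,
-- the second summand is negligible: C_a C_b grows when a and b are moved apart, so for M ≤ a, b
-- it is at most each of the first M terms of the convolution Σ C_i C_{a+b-i} = C_{a+b+1}.

open import Defs
open import Data.Empty using (⊥)
open import Data.Fin as Fin using (Fin; zero; suc; toℕ; fromℕ<; opposite)
import Data.Fin.Properties as Finₚ
import Data.Integer as ℤ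
open ℤ using () renaming (+_ to ⁺_)
import Data.Integer.Properties as ℤₚ
open import Data.List as List
  using (List; []; _∷_; _++_; length; map; filter; upTo; downFrom; concatMap; cartesianProduct; reverse; take; drop)
import Data.List.Properties as Listₚ
open import Data.List.Membership.Propositional using (_∈_; find; lose)
open import Data.List.Membership.Propositional.Properties
open import Data.List.Membership.Propositional.Properties.WithK using (unique∧set⇒bag)
open import Data.List.Relation.Binary.BagAndSetEquality using (∼bag⇒↭)
open import Data.List.Relation.Binary.Disjoint.Propositional using (Disjoint)
open import Data.List.Relation.Binary.Permutation.Propositional using (_↭_; ↭-sym; ↭⇒↭ₛ)
open import Data.List.Relation.Binary.Permutation.Propositional.Properties
  using (↭-length; ↭-reverse; ∈-resp-↭; shift)
import Data.List.Relation.Binary.Permutation.Setoid.Properties as SetoidPermₚ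
open import Data.List.Relation.Binary.Sublist.Propositional as Sub
  using (_⊆_; []; _∷_; _∷ʳ_; ⊆-refl; ⊆-trans; from∈; to∈)
import Data.List.Relation.Binary.Sublist.Propositional.Properties as Subₚ
open import Data.List.Relation.Unary.All as All using (All; []; _∷_)
import Data.List.Relation.Unary.All.Properties as Allₚ
open import Data.List.Relation.Unary.AllPairs as AllPairs using (AllPairs; []; _∷_)
import Data.List.Relation.Unary.AllPairs.Properties as AllPairsₚ
open import Data.List.Relation.Unary.Any using (here; there)
open import Data.List.Relation.Unary.Unique.Propositional using (Unique)
import Data.List.Relation.Unary.Unique.Propositional.Properties as Uniqueₚ
open import Data.Nat
  using (ℕ; zero; suc; _+_; _*_; _∸_; _^_; _⊓_; _≤_; _<_; _>_; z≤n; s≤s; s≤s⁻¹; NonZero)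
open import Data.Nat.Combinatorics using (_C_; nCk≡nC[n∸k]; nCk+nC[k+1]≡[n+1]C[k+1]; nC1≡n)
open import Data.Nat.ListAction using (sum)
open import Data.Nat.ListAction.Properties using (sum-++)
open import Data.Nat.Properties as ℕₚ
open import Data.Nat.Tactic.RingSolver using (solve-∀)
open import Data.Product using (∃; ∃₂; _×_; _,_; proj₁; proj₂)
open import Data.Rational as ℚ using (mkℚ; 0ℚ; 1ℚ; _/_)
  renaming (_+_ to _+ℚ_; _*_ to _*ℚ_; _-_ to _-ℚ_; _<_ to _<ℚ_; _≤_ to _≤ℚ_)
import Data.Rational.Properties as ℚₚ
open import Data.Rational.Unnormalised as ℚᵘ using (mkℚᵘ; *<*; *≤*; *≡*)
import Data.Rational.Unnormalised.Properties as ℚᵘₚ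
open import Data.Sum using (_⊎_; inj₁; inj₂; [_,_]′)
open import Data.Unit using (⊤; tt)
open import Data.Vec as Vec using (Vec; []; _∷_; lookup)
open import Function using (_∘_; id; _⇔_; mk⇔; module Equivalence)
open import Function.Consequences.Propositional
  using (strictlySurjective⇒surjective; surjective⇒strictlySurjective)
open import Function.Definitions using (Injective)
open import Relation.Binary using (tri<; tri≈; tri>)
open import Relation.Binary.PropositionalEquality
open import Relation.Nullary using (¬_; ¬?; Dec; yes; no; contradiction; _×-dec_)
open import Relation.Unary using (Decidable)

-- Ballot numbers and Catalan numbers

-- The ballot numbers carry three facts about C_n at once. They count the descendants of a node in
-- the generating tree of the 123-avoiders, which gives |S_n(123)| = C_n. The reflection principle
-- gives them a closed form, whence the ratio C_{n+1}/C_n that governs the limits. First passage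
-- gives the Catalan convolution, which controls the second summand when both of its indices are
-- large. The combinatorics is done on lists of natural numbers counted from 0, because contraction,
-- inflation and skew sums change the length and the alphabet of a word. For 321 the word is read
-- backwards, which turns 321 into 123 and leaves the values, hence the blocks, untouched. All
-- estimates stay inside the natural numbers. As C_{n+1} ≤ 4 C_n, the probabilities eventually lie
-- on or above their limits, so an upper bound of the form limit plus K/M, with M arbitrary and K
-- fixed, is enough.

ballot : ℕ → ℕ → ℕ
-- Counts the paths from height `s` to 0 with `n` up-steps that never go below 0, split by their
-- first step; at height 0 this step must go up, and without up-steps only the straight descent
-- remains.
ballot zero    s       = 1
ballot (suc n) zero    = ballot n 1
ballot (suc n) (suc s) = ballot (suc n) s + ballot n (suc (suc s))

Cat : ℕ → ℕ
Cat n = ballot n 0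

private
  -- N C (k - 1), read as 0 at k = 0.
  _C⁻_ : ℕ → ℕ → ℕ
  N C⁻ zero  = 0
  N C⁻ suc k = N C k

  pascal⁻ : ∀ N k → N C⁻ k + N C k ≡ suc N C⁻ suc k
  pascal⁻ N zero    = refl
  pascal⁻ N (suc k) = nCk+nC[k+1]≡[n+1]C[k+1] N k

absorption : ∀ n k → suc k * (suc n C suc k) ≡ suc n * (n C k)
absorption n       zero    = trans (*-identityˡ _) (trans (nC1≡n (suc n)) (sym (*-identityʳ (suc n))))
absorption zero    (suc k) = *-zeroʳ k
absorption (suc n) (suc k) = begin
  (2 + k) * (suc (suc n) C suc (suc k))           ≡⟨ cong ((2 + k) *_) (sym (pascal⁻ (suc n) (2 + k))) ⟩
  (2 + k) * (x + y)                               ≡⟨ expand k x y ⟩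
  x + (suc k * x + (2 + k) * y)                   ≡⟨ cong (x +_) (cong₂ _+_ (absorption n k) (absorption n (suc k))) ⟩
  x + (suc n * (n C k) + suc n * (n C suc k))      ≡⟨ cong (x +_) (sym (*-distribˡ-+ (suc n) (n C k) (n C suc k))) ⟩
  x + suc n * (n C k + n C suc k)                  ≡⟨ cong (λ z → x + suc n * z) (pascal⁻ n (suc k)) ⟩
  (2 + n) * x                                     ∎
  where
  open ≡-Reasoning
  x = suc n C suc k
  y = suc n C suc (suc k)
  expand : ∀ k x y → (2 + k) * (x + y) ≡ x + (suc k * x + (2 + k) * y)
  expand = solve-∀

absorption′ : ∀ n k → suc k * (n C suc k) + suc k * (n C k) ≡ suc n * (n C k)
absorption′ n k = begin
  suc k * (n C suc k) + suc k * (n C k) ≡⟨ sym (*-distribˡ-+ (suc k) (n C suc k) (n C k)) ⟩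
  suc k * (n C suc k + n C k)           ≡⟨ cong (suc k *_) (trans (+-comm (n C suc k) _) (pascal⁻ n (suc k))) ⟩
  suc k * (suc n C suc k)               ≡⟨ absorption n k ⟩
  suc n * (n C k)                       ∎
  where open ≡-Reasoning

private
  central-symmetry : ∀ n → (1 + 2 * n) C suc n ≡ (1 + 2 * n) C n
  central-symmetry n = trans (nCk≡nC[n∸k] (s≤s (m≤m+n n (n + 0)))) (cong ((1 + 2 * n) C_) (trans (m+n∸m≡n n (n + 0)) (+-identityʳ n)))

  -- Pascal's rule carries the difference of binomials through one step of the ballot recursion,
  -- with `b` the paths after a down-step and `b′` those after an up-step. At height 0 it is applied
  -- with `b` = 0, because there the two middle binomials coincide.
  closed-step : ∀ {N N₁ k b b′} → N₁ ≡ suc N → b + N C k ≡ N C suc k → b′ + N C⁻ k ≡ N C k →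
                b + b′ + N₁ C k ≡ N₁ C suc k
  closed-step {N} {k = k} {b} {b′} refl p q = begin
    b + b′ + suc N C k            ≡⟨ cong (b + b′ +_) (sym (pascal⁻ N k)) ⟩
    b + b′ + (N C⁻ k + N C k)     ≡⟨ shuffle b b′ (N C⁻ k) (N C k) ⟩
    (b′ + N C⁻ k) + (b + N C k)   ≡⟨ cong₂ _+_ q p ⟩
    N C k + N C suc k             ≡⟨ pascal⁻ N (suc k) ⟩
    suc N C suc k                 ∎
    where
    open ≡-Reasoning
    shuffle : ∀ a b c d → a + b + (c + d) ≡ (b + c) + (a + d)
    shuffle = solve-∀

-- The reflection principle for ballot paths.
ballot-closed : ∀ n s → ballot n s + (2 * n + s) C⁻ n ≡ (2 * n + s) C n
ballot-closed zero    s = refl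
ballot-closed (suc n) zero = closed-step {1 + 2 * n} {k = n} {0} {ballot n 1} (N≡ n) (sym (central-symmetry n))
    (subst (λ N → ballot n 1 + N C⁻ n ≡ N C n) (+-comm (2 * n) 1) (ballot-closed n 1))
  where
  N≡ : ∀ n → 2 * suc n + 0 ≡ suc (1 + 2 * n)
  N≡ = solve-∀
ballot-closed (suc n) (suc s) = closed-step {2 * suc n + s} {k = n} {ballot (suc n) s} {ballot n (2 + s)} (+-suc (2 * suc n) s)
    (ballot-closed (suc n) s)
    (subst (λ N → ballot n (2 + s) + N C⁻ n ≡ N C n) (N≡ n s) (ballot-closed n (2 + s)))
  where
  N≡ : ∀ n s → 2 * n + (2 + s) ≡ 2 * suc n + s
  N≡ = solve-∀

-- The reflected term C(2n, n-1) is n/(n+1) of the central binomial, so exactly 1/(n+1) of it is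
-- left.
Cat-closed : ∀ n → suc n * Cat n ≡ (2 * n) C n
Cat-closed n = +-cancelʳ-≡ (n * (2 * n C n)) _ _ (begin
  suc n * Cat n + n * (N C n)        ≡⟨ cong (suc n * Cat n +_) (sym (lower n)) ⟩
  suc n * Cat n + suc n * (N C⁻ n)   ≡⟨ sym (*-distribˡ-+ (suc n) (Cat n) (N C⁻ n)) ⟩
  suc n * (Cat n + N C⁻ n)           ≡⟨ cong (suc n *_) (subst (λ N → Cat n + N C⁻ n ≡ N C n) (+-identityʳ N) (ballot-closed n 0)) ⟩
  suc n * (N C n)                    ∎)
  where
  open ≡-Reasoning
  N = 2 * n
  lower : ∀ n → suc n * ((2 * n) C⁻ n) ≡ n * ((2 * n) C n)
  lower zero    = refl
  lower (suc m) = +-cancelʳ-≡ (suc m * x) _ _ (trans (sym (split m x)) (sym (absorption′ (2 * suc m) m)))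
    where
    x = (2 * suc m) C m
    split : ∀ m x → suc (2 * suc m) * x ≡ suc (suc m) * x + suc m * x
    split = solve-∀

central-rec : ∀ n → suc n * ((2 * suc n) C suc n) ≡ 2 * (suc (2 * n) * ((2 * n) C n))
central-rec n = begin
  suc n * ((2 * suc n) C suc n)              ≡⟨ cong (λ N → suc n * (N C suc n)) (2*suc n) ⟩
  suc n * ((2 + 2 * n) C suc n)              ≡⟨ absorption (1 + 2 * n) n ⟩
  (2 + 2 * n) * ((1 + 2 * n) C n)            ≡⟨ cong ((2 + 2 * n) *_) (sym (central-symmetry n)) ⟩
  (2 + 2 * n) * ((1 + 2 * n) C suc n)        ≡⟨ factor n ((1 + 2 * n) C suc n) ⟩
  2 * (suc n * ((1 + 2 * n) C suc n))        ≡⟨ cong (2 *_) (absorption (2 * n) n) ⟩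
  2 * (suc (2 * n) * ((2 * n) C n))          ∎
  where
  open ≡-Reasoning
  2*suc : ∀ n → 2 * suc n ≡ 2 + 2 * n
  2*suc = solve-∀
  factor : ∀ n x → (2 + 2 * n) * x ≡ 2 * (suc n * x)
  factor = solve-∀

-- The exact growth rate (4n+2)/(n+2) of the Catalan numbers. It increases with n and stays below 4
-- by 6/(n+2); every later estimate rests on one of these two properties.
Cat-rec : ∀ n → (2 + n) * Cat (suc n) ≡ (2 + 4 * n) * Cat n
Cat-rec n = *-cancelˡ-≡ _ _ (suc n) (begin
  suc n * ((2 + n) * Cat (suc n))         ≡⟨ cong (suc n *_) (Cat-closed (suc n)) ⟩
  suc n * ((2 * suc n) C suc n)           ≡⟨ central-rec n ⟩
  2 * (suc (2 * n) * ((2 * n) C n))       ≡⟨ cong (λ z → 2 * (suc (2 * n) * z)) (sym (Cat-closed n)) ⟩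
  2 * (suc (2 * n) * (suc n * Cat n))     ≡⟨ regroup n (Cat n) ⟩
  suc n * ((2 + 4 * n) * Cat n)           ∎)
  where
  open ≡-Reasoning
  regroup : ∀ n c → 2 * (suc (2 * n) * (suc n * c)) ≡ suc n * ((2 + 4 * n) * c)
  regroup = solve-∀

Cat-pos : ∀ n → 1 ≤ Cat n
Cat-pos n = ballot-pos n 0
  where
  ballot-pos : ∀ n s → 1 ≤ ballot n s
  ballot-pos zero    s       = ≤-refl
  ballot-pos (suc n) zero    = ballot-pos n 1
  ballot-pos (suc n) (suc s) = ≤-trans (ballot-pos (suc n) s) (m≤m+n _ _)

convolution : (ℕ → ℕ) → (ℕ → ℕ) → ℕ → ℕ
convolution f g zero    = f 0 * g 0
convolution f g (suc n) = f 0 * g (suc n) + convolution (λ i → f (suc i)) g n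

convolution-distribʳ-+ : ∀ f f′ g n →
  convolution (λ i → f i + f′ i) g n ≡ convolution f g n + convolution f′ g n
convolution-distribʳ-+ f f′ g zero    = *-distribʳ-+ (g 0) (f 0) (f′ 0)
convolution-distribʳ-+ f f′ g (suc n) = begin
  (f 0 + f′ 0) * g (suc n) + convolution (λ i → f (suc i) + f′ (suc i)) g n
    ≡⟨ cong ((f 0 + f′ 0) * g (suc n) +_) (convolution-distribʳ-+ (λ i → f (suc i)) (λ i → f′ (suc i)) g n) ⟩
  (f 0 + f′ 0) * g (suc n) + (convolution (λ i → f (suc i)) g n + convolution (λ i → f′ (suc i)) g n)
    ≡⟨ regroup (f 0) (f′ 0) (g (suc n)) _ _ ⟩
  convolution f g (suc n) + convolution f′ g (suc n) ∎
  where
  open ≡-Reasoning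
  regroup : ∀ a b c x y → (a + b) * c + (x + y) ≡ (a * c + x) + (b * c + y)
  regroup = solve-∀

-- First-passage decomposition of ballot paths; s = 0 is the Catalan recurrence.
ballot-convolution : ∀ n s → convolution (λ i → ballot i s) Cat n ≡ ballot n (suc s)
ballot-convolution zero    s       = refl
ballot-convolution (suc n) zero    = cong₂ _+_ (*-identityˡ (Cat (suc n))) (ballot-convolution n 1)
ballot-convolution (suc n) (suc s) = begin
  1 * Cat (suc n) + convolution (λ i → ballot (suc i) s + ballot i (2 + s)) Cat n
    ≡⟨ cong (1 * Cat (suc n) +_) (convolution-distribʳ-+ (λ i → ballot (suc i) s) (λ i → ballot i (2 + s)) Cat n) ⟩
  1 * Cat (suc n) + (convolution (λ i → ballot (suc i) s) Cat n + convolution (λ i → ballot i (2 + s)) Cat n)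
    ≡⟨ sym (+-assoc (1 * Cat (suc n)) _ _) ⟩
  convolution (λ i → ballot i s) Cat (suc n) + convolution (λ i → ballot i (2 + s)) Cat n
    ≡⟨ cong₂ _+_ (ballot-convolution (suc n) s) (ballot-convolution n (2 + s)) ⟩
  ballot (suc n) (2 + s) ∎
  where open ≡-Reasoning

-- Growth of the Catalan numbers

convolution-≥ : ∀ f g {c} M n → M ≤ n → (∀ i j → i + j ≡ n → i ≤ M → c ≤ f i * g j) →
                suc M * c ≤ convolution f g n
convolution-≥ f g {c} zero    zero    _         h = ≤-trans (≤-reflexive (*-identityˡ c)) (h 0 0 refl z≤n)
convolution-≥ f g {c} zero    (suc n) _         h =
  ≤-trans (≤-reflexive (*-identityˡ c)) (≤-trans (h 0 (suc n) refl z≤n) (m≤m+n _ _))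
convolution-≥ f g     (suc M) (suc n) (s≤s M≤n) h =
  +-mono-≤ (h 0 (suc n) refl z≤n)
    (convolution-≥ (λ i → f (suc i)) g M n M≤n (λ i j i+j≡n i≤M → h (suc i) j (cong suc i+j≡n) (s≤s i≤M)))

-- Log-convexity: the ratio C_{n+1}/C_n = (4n+2)/(n+2) increases with n. The claim is this
-- comparison of ratios at i and j, with the denominators cleared.
Cat-unbalance : ∀ {i j} → i ≤ j → Cat (suc i) * Cat j ≤ Cat i * Cat (suc j)
Cat-unbalance {i} {j} i≤j = *-cancelˡ-≤ ((2 + i) * (2 + j)) (begin
  (2 + i) * (2 + j) * (Cat (suc i) * Cat j)       ≡⟨ regroup₁ (2 + i) (2 + j) (Cat (suc i)) (Cat j) ⟩
  (2 + j) * ((2 + i) * Cat (suc i)) * Cat j       ≡⟨ cong (λ z → (2 + j) * z * Cat j) (Cat-rec i) ⟩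
  (2 + j) * ((2 + 4 * i) * Cat i) * Cat j         ≡⟨ regroup₂ (2 + j) (2 + 4 * i) (Cat i) (Cat j) ⟩
  (2 + j) * (2 + 4 * i) * (Cat i * Cat j)         ≤⟨ *-monoˡ-≤ (Cat i * Cat j) rate ⟩
  (2 + i) * (2 + 4 * j) * (Cat i * Cat j)         ≡⟨ regroup₃ (2 + i) (2 + 4 * j) (Cat i) (Cat j) ⟩
  (2 + i) * Cat i * ((2 + 4 * j) * Cat j)         ≡⟨ cong ((2 + i) * Cat i *_) (sym (Cat-rec j)) ⟩
  (2 + i) * Cat i * ((2 + j) * Cat (suc j))       ≡⟨ regroup₃′ (2 + i) (2 + j) (Cat i) (Cat (suc j)) ⟩
  (2 + i) * (2 + j) * (Cat i * Cat (suc j))       ∎)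
  where
  open ≤-Reasoning
  regroup₁ : ∀ a b x y → a * b * (x * y) ≡ b * (a * x) * y
  regroup₁ = solve-∀
  regroup₂ : ∀ a b x y → a * (b * x) * y ≡ a * b * (x * y)
  regroup₂ = solve-∀
  regroup₃ : ∀ a b x y → a * b * (x * y) ≡ a * x * (b * y)
  regroup₃ = solve-∀
  regroup₃′ : ∀ a b x y → a * x * (b * y) ≡ a * b * (x * y)
  regroup₃′ = solve-∀
  expand : ∀ i d → (2 + (i + d)) * (2 + 4 * i) + 6 * d ≡ (2 + i) * (2 + 4 * (i + d))
  expand = solve-∀
  rate : (2 + j) * (2 + 4 * i) ≤ (2 + i) * (2 + 4 * j)
  rate = subst (λ j → (2 + j) * (2 + 4 * i) ≤ (2 + i) * (2 + 4 * j)) (m+[n∸m]≡n i≤j)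
    (≤-trans (m≤m+n _ (6 * (j ∸ i))) (≤-reflexive (expand i (j ∸ i))))

-- `Cat-unbalance` iterated. Every move lowers the left index and raises the right one, so the
-- hypothesis is inherited.
Cat-unbalance⋆ : ∀ d {i j} → d + i ≤ suc j → Cat (d + i) * Cat j ≤ Cat i * Cat (d + j)
Cat-unbalance⋆ zero    _         = ≤-refl
Cat-unbalance⋆ (suc d) {i} {j} (s≤s d+i≤j) = ≤-trans (Cat-unbalance d+i≤j)
  (≤-trans (Cat-unbalance⋆ d {i} {suc j} (≤-trans d+i≤j (≤-trans (n≤1+n j) (n≤1+n _))))
    (≤-reflexive (cong (λ z → Cat i * Cat z) (+-suc d j))))

private
  Cat-*-bound-≤ : ∀ {M a b} → M ≤ a → a ≤ b → suc M * (Cat a * Cat b) ≤ Cat (suc (a + b))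
  Cat-*-bound-≤ {M} {a} {b} M≤a a≤b = ≤-trans
    (convolution-≥ Cat Cat M (a + b) (≤-trans M≤a (m≤m+n a b)) term)
    (≤-reflexive (ballot-convolution (a + b) 0))
    where
    open ≤-Reasoning
    term : ∀ i j → i + j ≡ a + b → i ≤ M → Cat a * Cat b ≤ Cat i * Cat j
    term i j i+j≡a+b i≤M = begin
      Cat a * Cat b                 ≡⟨ cong (λ z → Cat z * Cat b) (sym a≡) ⟩
      -- The pair (a, b) is moved apart by a - i and becomes (i, j).
      Cat (a ∸ i + i) * Cat b       ≤⟨ Cat-unbalance⋆ (a ∸ i) {i} {b} (≤-trans (≤-reflexive a≡) (≤-trans a≤b (n≤1+n b))) ⟩
      Cat i * Cat (a ∸ i + b)       ≡⟨ cong (λ z → Cat i * Cat z) (sym j≡) ⟩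
      Cat i * Cat j                 ∎
      where
      a≡ : a ∸ i + i ≡ a
      a≡ = m∸n+n≡m (≤-trans i≤M M≤a)
      j≡ : j ≡ a ∸ i + b
      j≡ = +-cancelˡ-≡ i _ _ (trans i+j≡a+b (trans (cong (_+ b) (trans (sym a≡) (+-comm (a ∸ i) i))) (+-assoc i (a ∸ i) b)))

Cat-*-bound : ∀ {M a b} → M ≤ a → M ≤ b → M * (Cat a * Cat b) ≤ Cat (suc (a + b))
Cat-*-bound {M} {a} {b} M≤a M≤b = ≤-trans (m≤n+m _ (Cat a * Cat b)) (byCases (≤-total a b))
  where
  byCases : a ≤ b ⊎ b ≤ a → suc M * (Cat a * Cat b) ≤ Cat (suc (a + b))
  byCases (inj₁ a≤b) = Cat-*-bound-≤ M≤a a≤b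
  byCases (inj₂ b≤a) = subst₂ (λ x y → suc M * x ≤ Cat (suc y)) (*-comm (Cat b) (Cat a)) (+-comm b a)
    (Cat-*-bound-≤ M≤b b≤a)

Cat-≤-suc : ∀ n → Cat n ≤ Cat (suc n)
Cat-≤-suc zero    = ≤-refl
Cat-≤-suc (suc n) = m≤m+n (Cat (suc n)) (ballot n 2)

Cat-mono : ∀ {m n} → m ≤ n → Cat m ≤ Cat n
Cat-mono {m} {n} m≤n = subst (λ n → Cat m ≤ Cat n) (m∸n+n≡m m≤n) (grow (n ∸ m))
  where
  grow : ∀ d → Cat m ≤ Cat (d + m)
  grow zero    = ≤-refl
  grow (suc d) = ≤-trans (grow d) (Cat-≤-suc (d + m))

private
  Cat-suc-deficit : ∀ n → 4 * ((2 + n) * Cat n) ≡ (2 + n) * Cat (suc n) + 6 * Cat n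
  Cat-suc-deficit n = trans (expand n (Cat n)) (cong (_+ 6 * Cat n) (sym (Cat-rec n)))
    where
    expand : ∀ n c → 4 * ((2 + n) * c) ≡ (2 + 4 * n) * c + 6 * c
    expand = solve-∀

Cat-suc-≤ : ∀ n → Cat (suc n) ≤ 4 * Cat n
Cat-suc-≤ n = *-cancelˡ-≤ (2 + n) (begin
  (2 + n) * Cat (suc n)                 ≤⟨ m≤m+n _ (6 * Cat n) ⟩
  (2 + n) * Cat (suc n) + 6 * Cat n     ≡⟨ sym (Cat-suc-deficit n) ⟩
  4 * ((2 + n) * Cat n)                 ≡⟨ swap (2 + n) (Cat n) ⟩
  (2 + n) * (4 * Cat n)                 ∎)
  where
  open ≤-Reasoning
  swap : ∀ a c → 4 * (a * c) ≡ a * (4 * c)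
  swap = solve-∀

Cat-+-≤ : ∀ m n → Cat (m + n) ≤ 4 ^ m * Cat n
Cat-+-≤ zero    n = ≤-reflexive (sym (*-identityˡ (Cat n)))
Cat-+-≤ (suc m) n = ≤-trans (Cat-suc-≤ (m + n))
  (≤-trans (*-monoʳ-≤ 4 (Cat-+-≤ m n)) (≤-reflexive (sym (*-assoc 4 (4 ^ m) (Cat n)))))

-- The deficit δ = 4 C_n - C_{n+1} satisfies (n+2) δ = 6 C_n ≤ 6 C_{n+1}, so the relative error of 4
-- C_n against C_{n+1} is at most 6/M.
Cat-suc-≥ : ∀ {M n} → M ≤ 2 + n → M * (4 * Cat n) ≤ (M + 6) * Cat (suc n)
Cat-suc-≥ {M} {n} M≤2+n = begin
  M * (4 * Cat n)                           ≡⟨ cong (M *_) (sym (m+[n∸m]≡n (Cat-suc-≤ n))) ⟩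
  M * (Cat (suc n) + δ)                     ≡⟨ *-distribˡ-+ M (Cat (suc n)) δ ⟩
  M * Cat (suc n) + M * δ                   ≤⟨ +-monoʳ-≤ (M * Cat (suc n)) (*-monoˡ-≤ δ M≤2+n) ⟩
  M * Cat (suc n) + (2 + n) * δ             ≡⟨ cong (M * Cat (suc n) +_) δ≡ ⟩
  M * Cat (suc n) + 6 * Cat n               ≤⟨ +-monoʳ-≤ (M * Cat (suc n)) (*-monoʳ-≤ 6 (Cat-≤-suc n)) ⟩
  M * Cat (suc n) + 6 * Cat (suc n)         ≡⟨ sym (*-distribʳ-+ (Cat (suc n)) M 6) ⟩
  (M + 6) * Cat (suc n)                     ∎
  where
  open ≤-Reasoning
  δ = 4 * Cat n ∸ Cat (suc n)
  swap : ∀ a c → a * (4 * c) ≡ 4 * (a * c)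
  swap = solve-∀
  δ≡ : (2 + n) * δ ≡ 6 * Cat n
  δ≡ = +-cancelˡ-≡ ((2 + n) * Cat (suc n)) _ _
    (trans (sym (*-distribˡ-+ (2 + n) (Cat (suc n)) δ))
      (trans (cong ((2 + n) *_) (m+[n∸m]≡n (Cat-suc-≤ n)))
        (trans (swap (2 + n) (Cat n)) (Cat-suc-deficit n))))

-- The error constant for m steps, explicitly 2 (4^m - 1): for M ≤ n the number 4^m C_n exceeds
-- C_{m+n} by a factor of at most 1 + gap m / M. A further step costs 6 and multiplies the old error
-- by 4, where C_{m+n} is crudely replaced by its successor.
gap : ℕ → ℕ
gap zero    = 0
gap (suc m) = 6 + 4 * gap m

Cat-+-≥ : ∀ {M n} m → M ≤ n → M * (4 ^ m * Cat n) ≤ (M + gap m) * Cat (m + n)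
Cat-+-≥ {M} {n} zero    M≤n = ≤-reflexive (cong₂ _*_ (sym (+-identityʳ M)) (*-identityˡ (Cat n)))
Cat-+-≥ {M} {n} (suc m) M≤n = begin
  M * (4 * 4 ^ m * Cat n)                                   ≡⟨ swap M (4 ^ m) (Cat n) ⟩
  4 * (M * (4 ^ m * Cat n))                                 ≤⟨ *-monoʳ-≤ 4 (Cat-+-≥ m M≤n) ⟩
  4 * ((M + gap m) * Cat (m + n))                           ≡⟨ split M (gap m) (Cat (m + n)) ⟩
  M * (4 * Cat (m + n)) + 4 * gap m * Cat (m + n)           ≤⟨ +-mono-≤ (Cat-suc-≥ M≤2+m+n) (*-monoʳ-≤ (4 * gap m) (Cat-≤-suc (m + n))) ⟩
  (M + 6) * Cat (suc m + n) + 4 * gap m * Cat (suc m + n)   ≡⟨ collect M (gap m) (Cat (suc m + n)) ⟩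
  (M + gap (suc m)) * Cat (suc m + n)                       ∎
  where
  open ≤-Reasoning
  M≤2+m+n : M ≤ 2 + (m + n)
  M≤2+m+n = ≤-trans M≤n (≤-trans (m≤n+m n m) (m≤n+m (m + n) 2))
  swap : ∀ M p c → M * (4 * p * c) ≡ 4 * (M * (p * c))
  swap = solve-∀
  split : ∀ M g c → 4 * ((M + g) * c) ≡ M * (4 * c) + 4 * g * c
  split = solve-∀
  collect : ∀ M g c → (M + 6) * c + 4 * g * c ≡ (M + (6 + 4 * g)) * c
  collect = solve-∀

-- Limits of ratios of natural numbers

private
  toℚᵘ-/ : ∀ a b → ℚ.toℚᵘ (⁺ a / suc b) ℚᵘ.≃ mkℚᵘ (⁺ a) b
  toℚᵘ-/ a b = ℚₚ.toℚᵘ-fromℚᵘ (mkℚᵘ (⁺ a) b)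

/-cong-* : ∀ a b c d .{{_ : NonZero b}} .{{_ : NonZero d}} → a * d ≡ c * b → ⁺ a / b ≡ ⁺ c / d
/-cong-* a (suc b) c (suc d) ad≡cb = ℚₚ.fromℚᵘ-cong {mkℚᵘ (⁺ a) b} {mkℚᵘ (⁺ c) d} (*≡*
  (trans (sym (ℤₚ.pos-* a (suc d))) (trans (cong ⁺_ ad≡cb) (ℤₚ.pos-* c (suc b)))))

/-mono-≤ : ∀ a b c d .{{_ : NonZero b}} .{{_ : NonZero d}} → a * d ≤ c * b → ⁺ a / b ≤ℚ ⁺ c / d
/-mono-≤ a (suc b) c (suc d) ad≤cb = ℚₚ.toℚᵘ-cancel-≤
  (ℚᵘₚ.≤-respˡ-≃ (ℚᵘₚ.≃-sym (toℚᵘ-/ a b)) (ℚᵘₚ.≤-respʳ-≃ (ℚᵘₚ.≃-sym (toℚᵘ-/ c d))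
    (*≤* (subst₂ ℤ._≤_ (ℤₚ.pos-* a (suc d)) (ℤₚ.pos-* c (suc b)) (ℤ.+≤+ ad≤cb)))))

/-mono-< : ∀ a b c d .{{_ : NonZero b}} .{{_ : NonZero d}} → a * d < c * b → ⁺ a / b <ℚ ⁺ c / d
/-mono-< a (suc b) c (suc d) ad<cb = ℚₚ.toℚᵘ-cancel-<
  (ℚᵘₚ.<-respˡ-≃ (ℚᵘₚ.≃-sym (toℚᵘ-/ a b)) (ℚᵘₚ.<-respʳ-≃ (ℚᵘₚ.≃-sym (toℚᵘ-/ c d))
    (*<* (subst₂ ℤ._<_ (ℤₚ.pos-* a (suc d)) (ℤₚ.pos-* c (suc b)) (ℤ.+<+ ad<cb)))))

/-+-/ : ∀ a b c d .{{_ : NonZero b}} .{{_ : NonZero d}} .{{_ : NonZero (b * d)}} →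
        ⁺ a / b +ℚ ⁺ c / d ≡ ⁺ (a * d + c * b) / (b * d)
/-+-/ a (suc b) c (suc d) = ℚₚ.toℚᵘ-injective (begin
  ℚ.toℚᵘ (⁺ a / suc b +ℚ ⁺ c / suc d)                 ≈⟨ ℚₚ.toℚᵘ-homo-+ (⁺ a / suc b) (⁺ c / suc d) ⟩
  ℚ.toℚᵘ (⁺ a / suc b) ℚᵘ.+ ℚ.toℚᵘ (⁺ c / suc d)      ≈⟨ ℚᵘₚ.+-cong (toℚᵘ-/ a b) (toℚᵘ-/ c d) ⟩
  mkℚᵘ (⁺ a) b ℚᵘ.+ mkℚᵘ (⁺ c) d                      ≈⟨ *≡* (cong (ℤ._* ⁺ suc (d + b * suc d)) num) ⟩
  mkℚᵘ (⁺ (a * suc d + c * suc b)) (d + b * suc d)    ≈⟨ ℚᵘₚ.≃-sym (toℚᵘ-/ (a * suc d + c * suc b) (d + b * suc d)) ⟩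
  ℚ.toℚᵘ (⁺ (a * suc d + c * suc b) / (suc b * suc d)) ∎)
  where
  open ℚᵘₚ.≃-Reasoning
  num : ⁺ a ℤ.* ⁺ suc d ℤ.+ ⁺ c ℤ.* ⁺ suc b ≡ ⁺ (a * suc d + c * suc b)
  num = cong₂ ℤ._+_ (sym (ℤₚ.pos-* a (suc d))) (sym (ℤₚ.pos-* c (suc b)))

/-*-/ : ∀ a b c d .{{_ : NonZero b}} .{{_ : NonZero d}} .{{_ : NonZero (b * d)}} →
        ⁺ a / b *ℚ (⁺ c / d) ≡ ⁺ (a * c) / (b * d)
/-*-/ a (suc b) c (suc d) = ℚₚ.toℚᵘ-injective (begin
  ℚ.toℚᵘ (⁺ a / suc b *ℚ (⁺ c / suc d))                 ≈⟨ ℚₚ.toℚᵘ-homo-* (⁺ a / suc b) (⁺ c / suc d) ⟩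
  ℚ.toℚᵘ (⁺ a / suc b) ℚᵘ.* ℚ.toℚᵘ (⁺ c / suc d)      ≈⟨ ℚᵘₚ.*-cong (toℚᵘ-/ a b) (toℚᵘ-/ c d) ⟩
  mkℚᵘ (⁺ a) b ℚᵘ.* mkℚᵘ (⁺ c) d                      ≈⟨ *≡* (cong (ℤ._* ⁺ suc (d + b * suc d)) (sym (ℤₚ.pos-* a c))) ⟩
  mkℚᵘ (⁺ (a * c)) (d + b * suc d)                    ≈⟨ ℚᵘₚ.≃-sym (toℚᵘ-/ (a * c) (d + b * suc d)) ⟩
  ℚ.toℚᵘ (⁺ (a * c) / (suc b * suc d))                ∎)
  where open ℚᵘₚ.≃-Reasoning

private
  -- The numerator of a positive rational is at least 1. Thus ε may be replaced by the reciprocal of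
  -- its denominator, which keeps the estimates integral.
  1/↧ : ∀ ε → 0ℚ <ℚ ε → ⁺ 1 / ℚ.↧ₙ ε ≤ℚ ε
  1/↧ ε@(mkℚ (⁺ suc e) d _) _ = subst (⁺ 1 / suc d ≤ℚ_) (ℚₚ.↥p/↧p≡p ε)
    (/-mono-≤ 1 (suc d) (suc e) (suc d) (*-monoˡ-≤ (suc d) {1} {suc e} (s≤s z≤n)))
  1/↧ (mkℚ (⁺ zero) _ _)     (ℚ.*<* (ℤ.+<+ ()))
  1/↧ (mkℚ (ℤ.-[1+ _ ]) _ _) (ℚ.*<* ())

  -- One-sided, because the sequences in question approach their limits from above.
  ∣x-L∣<ε : ∀ {x L ε} → L ≤ℚ x → x <ℚ L +ℚ ε → ℚ.∣ x -ℚ L ∣ <ℚ ε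
  ∣x-L∣<ε {x} {L} {ε} L≤x x<L+ε = subst (_<ℚ ε) (sym (ℚₚ.0≤p⇒∣p∣≡p (subst (_≤ℚ x -ℚ L) (ℚₚ.+-inverseʳ L) (ℚₚ.+-monoˡ-≤ (ℚ.- L) L≤x))))
    (subst (x -ℚ L <ℚ_) cancel (ℚₚ.+-monoˡ-< (ℚ.- L) x<L+ε))
    where
    open ≡-Reasoning
    cancel : L +ℚ ε -ℚ L ≡ ε
    cancel = begin
      L +ℚ ε -ℚ L      ≡⟨ cong (_-ℚ L) (ℚₚ.+-comm L ε) ⟩
      ε +ℚ L -ℚ L      ≡⟨ ℚₚ.+-assoc ε L (ℚ.- L) ⟩
      ε +ℚ (L -ℚ L)    ≡⟨ cong (ε +ℚ_) (ℚₚ.+-inverseʳ L) ⟩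
      ε +ℚ 0ℚ          ≡⟨ ℚₚ.+-identityʳ ε ⟩
      ε                ∎

  -- The choice M = K d + 1 gives K/M < 1/d, and the remaining factor 1/b ≤ 1 is given away.
  scaled-bound : ∀ p q a b d K .{{_ : NonZero q}} .{{_ : NonZero b}} →
    let M = suc (K * d) in M * (b * p) ≤ (M * a + K) * q → p * (b * d) < (a * d + 1 * b) * q
  scaled-bound p q@(suc q′) a b@(suc b′) d K h = *-cancelˡ-< M _ _ (begin-strict
    M * (p * (b * d))              ≡⟨ lhs M p b d ⟩
    M * (b * p) * d                ≤⟨ *-monoˡ-≤ d h ⟩
    (M * a + K) * q * d            ≡⟨ mid M a K q d ⟩
    M * a * d * q + K * d * q      <⟨ +-monoʳ-< (M * a * d * q) (*-monoˡ-< q (n<1+n (K * d))) ⟩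
    M * a * d * q + M * q          ≤⟨ +-monoʳ-≤ (M * a * d * q) (*-monoˡ-≤ q (m≤m*n M b)) ⟩
    M * a * d * q + M * b * q      ≡⟨ rhs M a b d q ⟩
    M * ((a * d + 1 * b) * q)      ∎)
    where
    open ≤-Reasoning
    M = suc (K * d)
    lhs : ∀ M p b d → M * (p * (b * d)) ≡ M * (b * p) * d
    lhs = solve-∀
    mid : ∀ M a K q d → (M * a + K) * q * d ≡ M * a * d * q + K * d * q
    mid = solve-∀
    rhs : ∀ M a b d q → M * a * d * q + M * b * q ≡ M * ((a * d + 1 * b) * q)
    rhs = solve-∀

-- The hypothesis says 0 ≤ p/q − a/b ≤ K/(M b) eventually, for every M.
ratio-⟶ : ∀ (p q : ℕ → ℕ) (q≢0 : ∀ n → NonZero (q n)) a b .{{_ : NonZero b}} K →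
  (∀ M → ∃ λ N → ∀ n → N ≤ n → a * q n ≤ b * p n × M * (b * p n) ≤ (M * a + K) * q n) →
  (λ n → (⁺ p n / q n) {{q≢0 n}}) ⟶ ⁺ a / b
ratio-⟶ p q q≢0 a b@(suc _) K h ε 0<ε = N , λ n N≤n → close n (hN n N≤n)
  where
  d = ℚ.↧ₙ ε
  N = proj₁ (h (suc (K * d)))
  hN = proj₂ (h (suc (K * d)))
  close : ∀ n → a * q n ≤ b * p n × suc (K * d) * (b * p n) ≤ (suc (K * d) * a + K) * q n →
          ℚ.∣ (⁺ p n / q n) {{q≢0 n}} -ℚ ⁺ a / b ∣ <ℚ ε
  close n (lower , upper) = ∣x-L∣<ε
    (/-mono-≤ a b (p n) (q n) (≤-trans lower (≤-reflexive (*-comm b (p n)))))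
    (ℚₚ.<-≤-trans
      (/-mono-< (p n) (q n) (a * d + 1 * b) (b * d) (scaled-bound (p n) (q n) a b d K upper))
      (ℚₚ.≤-trans (ℚₚ.≤-reflexive (sym (/-+-/ a b 1 d))) (ℚₚ.+-monoʳ-≤ (⁺ a / b) (1/↧ ε 0<ε))))
    where instance _ = q≢0 n

catalan-Cat : ∀ j → catalan j ≡ ⁺ Cat j / 1
catalan-Cat j = /-cong-* ((2 * j) C j) (suc j) (Cat j) 1
  (trans (*-identityʳ _) (trans (sym (Cat-closed j)) (*-comm (suc j) (Cat j))))

-- Since C_j ≥ 1, the rational difference in the limit agrees with the truncated difference that
-- counts the non-decreasing avoiders.
catalan-1 : ∀ j → catalan j -ℚ 1ℚ ≡ ⁺ (Cat j ∸ 1) / 1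
catalan-1 j = begin
  catalan j -ℚ 1ℚ                       ≡⟨ cong (_-ℚ 1ℚ) (catalan-Cat j) ⟩
  ⁺ Cat j / 1 -ℚ 1ℚ                     ≡⟨ cong (λ c → ⁺ c / 1 -ℚ 1ℚ) (sym (m∸n+n≡m (Cat-pos j))) ⟩
  ⁺ (Cat j ∸ 1 + 1) / 1 -ℚ 1ℚ           ≡⟨ cong (λ c → ⁺ (c + 1) / 1 -ℚ 1ℚ) (sym (*-identityʳ (Cat j ∸ 1))) ⟩
  ⁺ ((Cat j ∸ 1) * 1 + 1) / 1 -ℚ 1ℚ     ≡⟨ cong (_-ℚ 1ℚ) (sym (/-+-/ (Cat j ∸ 1) 1 1 1)) ⟩
  ⁺ (Cat j ∸ 1) / 1 +ℚ 1ℚ -ℚ 1ℚ         ≡⟨ ℚₚ.+-assoc (⁺ (Cat j ∸ 1) / 1) 1ℚ (ℚ.- 1ℚ) ⟩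
  ⁺ (Cat j ∸ 1) / 1 +ℚ (1ℚ -ℚ 1ℚ)       ≡⟨ cong (⁺ (Cat j ∸ 1) / 1 +ℚ_) (ℚₚ.+-inverseʳ 1ℚ) ⟩
  ⁺ (Cat j ∸ 1) / 1 +ℚ 0ℚ               ≡⟨ ℚₚ.+-identityʳ _ ⟩
  ⁺ (Cat j ∸ 1) / 1                     ∎
  where open ≡-Reasoning

-- Brings the limit to the common denominator 4^(k+l-1), where k = κ + 1 and l = m + 1; there
-- 1/4^(l-1) has the numerator 4^k.
limit-closed : ∀ κ m e → e ≡ suc κ + m →
  1/4^ m +ℚ catalan κ *ℚ (catalan (suc m) -ℚ 1ℚ) *ℚ 1/4^ e
    ≡ (⁺ (4 ^ suc κ + Cat κ * (Cat (suc m) ∸ 1)) / (4 ^ e)) {{m^n≢0 4 e}}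
limit-closed κ m e e≡ = begin
  1/4^ m +ℚ catalan κ *ℚ (catalan (suc m) -ℚ 1ℚ) *ℚ 1/4^ e
    ≡⟨ cong₂ (λ x y → 1/4^ m +ℚ x *ℚ y *ℚ 1/4^ e) (catalan-Cat κ) (catalan-1 (suc m)) ⟩
  1/4^ m +ℚ (⁺ Cat κ / 1) *ℚ (⁺ c / 1) *ℚ 1/4^ e
    ≡⟨ cong (λ x → 1/4^ m +ℚ x *ℚ 1/4^ e) (/-*-/ (Cat κ) 1 c 1) ⟩
  1/4^ m +ℚ ⁺ (Cat κ * c) / 1 *ℚ 1/4^ e
    ≡⟨ cong (1/4^ m +ℚ_) (/-*-/ (Cat κ * c) 1 1 (4 ^ e)) ⟩
  1/4^ m +ℚ ⁺ (Cat κ * c * 1) / (1 * 4 ^ e)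
    ≡⟨ cong₂ _+ℚ_
        (/-cong-* 1 (4 ^ m) (4 ^ suc κ) (4 ^ e) (trans (*-identityˡ (4 ^ e)) (trans (cong (4 ^_) e≡) (^-distribˡ-+-* 4 (suc κ) m))))
        (/-cong-* (Cat κ * c * 1) (1 * 4 ^ e) (Cat κ * c) (4 ^ e) (swap (Cat κ * c) (4 ^ e))) ⟩
  ⁺ (4 ^ suc κ) / (4 ^ e) +ℚ ⁺ (Cat κ * c) / (4 ^ e)
    ≡⟨ /-+-/ (4 ^ suc κ) (4 ^ e) (Cat κ * c) (4 ^ e) ⟩
  ⁺ (4 ^ suc κ * 4 ^ e + Cat κ * c * 4 ^ e) / (4 ^ e * 4 ^ e)
    ≡⟨ /-cong-* (4 ^ suc κ * 4 ^ e + Cat κ * c * 4 ^ e) (4 ^ e * 4 ^ e) (4 ^ suc κ + Cat κ * c) (4 ^ e)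
        (collect (4 ^ suc κ) (Cat κ * c) (4 ^ e)) ⟩
  ⁺ (4 ^ suc κ + Cat κ * c) / (4 ^ e) ∎
  where
  open ≡-Reasoning
  c = Cat (suc m) ∸ 1
  instance
    4^m : NonZero (4 ^ m)
    4^m = m^n≢0 4 m
    4^e : NonZero (4 ^ e)
    4^e = m^n≢0 4 e
    1*4^e : NonZero (1 * 4 ^ e)
    1*4^e = m*n≢0 1 (4 ^ e)
    4^e*4^e : NonZero (4 ^ e * 4 ^ e)
    4^e*4^e = m*n≢0 (4 ^ e) (4 ^ e)
  swap : ∀ x y → x * 1 * y ≡ x * (1 * y)
  swap = solve-∀
  collect : ∀ x y z → (x * z + y * z) * z ≡ (x + y) * (z * z)
  collect = solve-∀

-- Permutations avoiding 123, as lists of natural numbers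

private
  variable
    A B : Set
    V W : A → Set
    xs ys : List A

-- Cardinalities are compared through lists that contain each solution of a predicate exactly once.
-- A permutation is the same notion applied to `_< n`, so the lemmas below serve both for counting
-- permutations and for building them.
record Enumerates {A : Set} (V : A → Set) (xs : List A) : Set where
  field
    unique   : Unique xs
    sound    : ∀ {x} → x ∈ xs → V x
    complete : ∀ {x} → V x → x ∈ xs

open Enumerates public

enum-length : Enumerates V xs → Enumerates V ys → length xs ≡ length ys
enum-length e f = ↭-length (∼bag⇒↭ (unique∧set⇒bag (unique e) (unique f)
  (mk⇔ (complete f ∘ sound e) (complete e ∘ sound f))))

enum-⇔ : (∀ {x} → V x → W x) → (∀ {x} → W x → V x) → Enumerates V xs → Enumerates W xs
enum-⇔ V⇒W W⇒V e = record { unique = unique e ; sound = V⇒W ∘ sound e ; complete = complete e ∘ W⇒V }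

enum-filter : {P : A → Set} (P? : Decidable P) → Enumerates V xs → Enumerates (λ x → V x × P x) (filter P? xs)
enum-filter P? e = record
  { unique   = Uniqueₚ.filter⁺ P? (unique e)
  ; sound    = λ x∈ → let x∈xs , Px = ∈-filter⁻ P? x∈ in sound e x∈xs , Px
  ; complete = λ (Vx , Px) → ∈-filter⁺ P? (complete e Vx) Px
  }

enum-++ : Enumerates V xs → Enumerates W ys → (∀ {x} → V x → W x → ⊥) →
          Enumerates (λ x → V x ⊎ W x) (xs ++ ys)
enum-++ {xs = xs} e f disjoint = record
  { unique   = Uniqueₚ.++⁺ (unique e) (unique f) (λ (x∈xs , x∈ys) → disjoint (sound e x∈xs) (sound f x∈ys))
  ; sound    = [ inj₁ ∘ sound e , inj₂ ∘ sound f ]′ ∘ ∈-++⁻ xs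
  ; complete = [ ∈-++⁺ˡ ∘ complete e , ∈-++⁺ʳ xs ∘ complete f ]′
  }

enum-× : {V : A → Set} {W : B → Set} {xs : List A} {ys : List B} → Enumerates V xs → Enumerates W ys →
         Enumerates (λ (x , y) → V x × W y) (cartesianProduct xs ys)
enum-× {xs = xs} {ys} e f = record
  { unique   = Uniqueₚ.cartesianProduct⁺ (unique e) (unique f)
  ; sound    = λ z∈ → let x∈xs , y∈ys = ∈-cartesianProduct⁻ xs ys z∈ in sound e x∈xs , sound f y∈ys
  ; complete = λ (Vx , Wy) → ∈-cartesianProduct⁺ (complete e Vx) (complete f Wy)
  }

enum-map : {V : A → Set} {W : B → Set} {xs : List A} (f : A → B) (g : B → A) →
           (∀ {x} → V x → W (f x)) → (∀ {x} → V x → g (f x) ≡ x) →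
           (∀ {y} → W y → V (g y)) → (∀ {y} → W y → f (g y) ≡ y) →
           Enumerates V xs → Enumerates W (map f xs)
enum-map {W = W} {xs} f g Wf gf Vg fg e = record
  { unique   = Uniqueₚ.map⁻ (subst Unique (sym gf-xs) (unique e))
  ; sound    = λ y∈ → let x , x∈xs , y≡fx = ∈-map⁻ f y∈ in subst W (sym y≡fx) (Wf (sound e x∈xs))
  ; complete = λ Wy → subst (_∈ map f xs) (fg Wy) (∈-map⁺ f (complete e (Vg Wy)))
  }
  where
  gf-xs : map g (map f xs) ≡ xs
  gf-xs = trans (sym (Listₚ.map-∘ xs)) (Listₚ.map-id-local (All.tabulate (gf ∘ sound e)))

enum-↭ : xs ↭ ys → Enumerates V xs → Enumerates V ys
enum-↭ {xs = xs} xs↭ys e = record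
  { unique   = SetoidPermₚ.Unique-resp-↭ (setoid _) (↭⇒↭ₛ xs↭ys) (unique e)
  ; sound    = sound e ∘ ∈-resp-↭ (↭-sym xs↭ys)
  ; complete = ∈-resp-↭ xs↭ys ∘ complete e
  }

unique-++⁻ : ∀ (xs : List A) {ys} → Unique (xs ++ ys) → Unique xs × Unique ys × Disjoint xs ys
unique-++⁻ []       u          = [] , u , λ ()
unique-++⁻ (x ∷ xs) (x≢ ∷ u)   = let uˡ , uʳ , disjoint = unique-++⁻ xs u in
  Allₚ.++⁻ˡ xs x≢ ∷ uˡ , uʳ ,
  λ { (here refl , x∈ys) → All.lookup x≢ (∈-++⁺ʳ xs x∈ys) refl ; (there x∈xs , x∈ys) → disjoint (x∈xs , x∈ys) }

IsPerm : ℕ → List ℕ → Set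
IsPerm n = Enumerates (_< n)

Decreasing : List ℕ → Set
Decreasing = AllPairs _>_

-- Occurrences are sublists rather than triples of positions, so that they can be followed through
-- concatenation, filtering and mapping.
Avoids123 : List ℕ → Set
Avoids123 w = ∀ x y z → x ∷ y ∷ z ∷ [] ⊆ w → x < y → y < z → ⊥

⊆-++⁻ : ∀ {s : List A} p {q} → s ⊆ p ++ q → ∃₂ λ s₁ s₂ → s ≡ s₁ ++ s₂ × s₁ ⊆ p × s₂ ⊆ q
⊆-++⁻ []      s⊆q          = [] , _ , refl , [] , s⊆q
⊆-++⁻ (x ∷ p) (.x ∷ʳ s⊆)   = let s₁ , s₂ , eq , s₁⊆p , s₂⊆q = ⊆-++⁻ p s⊆ in s₁ , s₂ , eq , x ∷ʳ s₁⊆p , s₂⊆q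
⊆-++⁻ (x ∷ p) (refl ∷ s⊆)  = let s₁ , s₂ , eq , s₁⊆p , s₂⊆q = ⊆-++⁻ p s⊆ in x ∷ s₁ , s₂ , cong (x ∷_) eq , refl ∷ s₁⊆p , s₂⊆q

decreasing-⊆ : ∀ {x y w} → Decreasing w → x ∷ y ∷ [] ⊆ w → y < x
decreasing-⊆ (_ ∷ d)  (_ ∷ʳ xy⊆)  = decreasing-⊆ d xy⊆
decreasing-⊆ (x> ∷ _) (refl ∷ y⊆) = All.lookup x> (to∈ y⊆)

¬ascent⇒decreasing : ∀ {w} → Unique w → (∀ {x y} → x ∷ y ∷ [] ⊆ w → x < y → ⊥) → Decreasing w
¬ascent⇒decreasing []      _       = []
¬ascent⇒decreasing (x≢ ∷ u) ¬ascent =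
  All.tabulate (λ y∈ → ≤∧≢⇒< (≮⇒≥ (¬ascent (refl ∷ from∈ y∈))) (All.lookup x≢ y∈ ∘ sym))
  ∷ ¬ascent⇒decreasing u (λ xy⊆ → ¬ascent (_ ∷ʳ xy⊆))

avoids123-⊆ : ∀ {v w} → v ⊆ w → Avoids123 w → Avoids123 v
avoids123-⊆ v⊆w av x y z xyz⊆ = av x y z (⊆-trans xyz⊆ v⊆w)

-- A letter that exceeds everything after it can only be the 3 of an occurrence, and then the 1 and
-- the 2 would form an ascent in the decreasing prefix.
avoids123-insert-max : ∀ {n} p {q} → (∀ {x} → x ∈ q → x < n) → Decreasing p →
                       Avoids123 (p ++ q) → Avoids123 (p ++ n ∷ q)
avoids123-insert-max {n} p {q} q<n dec av x y z xyz⊆ x<y y<z with ⊆-++⁻ p xyz⊆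
... | s₁ , s₂ , eq , s₁⊆p , (.n ∷ʳ s₂⊆q) = av x y z (subst (_⊆ p ++ q) (sym eq) (Subₚ.++⁺ s₁⊆p s₂⊆q)) x<y y<z
... | []             , _ , refl , _    , (refl ∷ s₂⊆q) = <-asym x<y (q<n (Sub.lookup s₂⊆q (here refl)))
... | _ ∷ []         , _ , refl , _    , (refl ∷ s₂⊆q) = <-asym y<z (q<n (Sub.lookup s₂⊆q (here refl)))
... | _ ∷ _ ∷ []     , _ , refl , s₁⊆p , (refl ∷ _)    = <-asym x<y (decreasing-⊆ dec s₁⊆p)
... | _ ∷ _ ∷ _ ∷ []    , _ , () , _ , (refl ∷ _)
... | _ ∷ _ ∷ _ ∷ _ ∷ _ , _ , () , _ , (refl ∷ _)

isPerm-insert : ∀ {n w} → IsPerm n w → IsPerm (suc n) (n ∷ w)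
isPerm-insert {n} {w} e = record
  { unique   = All.tabulate (λ x∈ n≡x → <-irrefl (sym n≡x) (sound e x∈)) ∷ unique e
  ; sound    = λ { (here refl) → n<1+n n ; (there x∈) → m<n⇒m<1+n (sound e x∈) }
  ; complete = λ x<1+n → [ there ∘ complete e , here ]′ (m<1+n⇒m<n∨m≡n x<1+n)
  }

isPerm-delete : ∀ {n w} → IsPerm (suc n) (n ∷ w) → IsPerm n w
isPerm-delete {n} {w} e@record { unique = x≢ ∷ u } = record
  { unique   = u
  ; sound    = λ x∈ → ≤∧≢⇒< (s≤s⁻¹ (sound e (there x∈))) (All.lookup x≢ x∈ ∘ sym)
  ; complete = λ x<n → tail x<n (complete e (m<n⇒m<1+n x<n))
  }
  where
  tail : ∀ {x} → x < n → x ∈ n ∷ w → x ∈ w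
  tail x<n (here refl) = contradiction x<n (<-irrefl refl)
  tail x<n (there x∈)  = x∈

-- The generating tree of the 123-avoiders: n may be inserted only behind a decreasing prefix (below b in the recursion).
insertions : ℕ → ℕ → List ℕ → List (List ℕ)
insertions b n []      = (n ∷ []) ∷ []
insertions b n (x ∷ w) with x ℕₚ.<? b
... | yes _ = (n ∷ x ∷ w) ∷ map (x ∷_) (insertions x n w)
... | no  _ = (n ∷ x ∷ w) ∷ []

-- The label of a node of the generating tree.
run : ℕ → List ℕ → ℕ
run b []      = 0
run b (x ∷ w) with x ℕₚ.<? b
... | yes _ = suc (run x w)
... | no  _ = 0

run-yes : ∀ {b x} w → x < b → run b (x ∷ w) ≡ suc (run x w)
run-yes {b} {x} w x<b with x ℕₚ.<? b
... | yes _  = refl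
... | no x≮b = contradiction x<b x≮b

run-no : ∀ {b x} w → b ≤ x → run b (x ∷ w) ≡ 0
run-no {b} {x} w b≤x with x ℕₚ.<? b
... | yes x<b = contradiction x<b (≤⇒≯ b≤x)
... | no _    = refl

private
  map-run-∷ : ∀ {b x} → x < b → ∀ ws → map (run b) (map (x ∷_) ws) ≡ map suc (map (run x) ws)
  map-run-∷ x<b ws = trans (sym (Listₚ.map-∘ ws)) (trans (Listₚ.map-cong (λ w → run-yes w x<b) ws) (Listₚ.map-∘ ws))

-- With `b ≤ n` the inserted `n` always ends the run, so the label is the position of insertion. In
-- particular the insertions are pairwise distinct.
map-run-insertions : ∀ {b n} w → b ≤ n → map (run b) (insertions b n w) ≡ upTo (suc (run b w))
map-run-insertions []      b≤n = cong (_∷ []) (run-no [] b≤n)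
map-run-insertions {b} (x ∷ w) b≤n with x ℕₚ.<? b
... | no _    = cong (_∷ []) (run-no (x ∷ w) b≤n)
... | yes x<b = cong₂ _∷_ (run-no (x ∷ w) b≤n) (trans (map-run-∷ x<b _)
  (trans (cong (map suc) (map-run-insertions w (<⇒≤ (<-≤-trans x<b b≤n)))) (Listₚ.map-upTo suc _)))

-- The succession rule: a node of label d has children of labels d+1, 1, ..., d. In front, `n`
-- prolongs the decreasing prefix by one; further back, the prefix ends just before `n`.
map-run-insert-max : ∀ n w → map (run (suc n)) (insertions n n w) ≡ suc (run n w) ∷ map suc (upTo (run n w))
map-run-insert-max n []      = cong (_∷ []) (run-yes [] (n<1+n n))
map-run-insert-max n (x ∷ w) with x ℕₚ.<? n in eq
... | no _    = cong (_∷ []) (trans (run-yes (x ∷ w) (n<1+n n)) (cong suc run≡0))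
  where
  run≡0 : run n (x ∷ w) ≡ 0
  run≡0 rewrite eq = refl
... | yes x<n = cong₂ _∷_ (trans (run-yes (x ∷ w) (n<1+n n)) (cong suc (run-yes w x<n)))
  (trans (map-run-∷ (m<n⇒m<1+n x<n) _) (cong (map suc) (map-run-insertions w (<⇒≤ x<n))))

∈-insertions⁻ : ∀ {b n v} w → v ∈ insertions b n w →
                ∃₂ λ p q → w ≡ p ++ q × v ≡ p ++ n ∷ q × Decreasing (b ∷ p)
∈-insertions⁻ [] (here refl) = [] , [] , refl , refl , [] ∷ []
∈-insertions⁻ {b} (x ∷ w) v∈ with x ℕₚ.<? b
∈-insertions⁻ (x ∷ w) (here refl) | no _  = [] , x ∷ w , refl , refl , [] ∷ []
∈-insertions⁻ (x ∷ w) (here refl) | yes _ = [] , x ∷ w , refl , refl , [] ∷ []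
∈-insertions⁻ (x ∷ w) (there v∈)  | yes x<b
  with ∈-map⁻ (x ∷_) v∈
... | _ , v∈′ , refl with ∈-insertions⁻ w v∈′
... | p , q , refl , refl , x>p ∷ dec =
  x ∷ p , q , refl , refl , (x<b ∷ All.map (λ y<x → <-trans y<x x<b) x>p) ∷ x>p ∷ dec

∈-insertions⁺ : ∀ {b n} p q → Decreasing (b ∷ p) → p ++ n ∷ q ∈ insertions b n (p ++ q)
∈-insertions⁺     []      []      _ = here refl
∈-insertions⁺ {b} []      (x ∷ q) _ with x ℕₚ.<? b
... | yes _ = here refl
... | no  _ = here refl
∈-insertions⁺ {b} (x ∷ p) q ((x<b ∷ _) ∷ dec) with x ℕₚ.<? b
... | yes _  = there (∈-map⁺ (x ∷_) (∈-insertions⁺ p q dec))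
... | no x≮b = contradiction x<b x≮b

avoiders123 : ℕ → List (List ℕ)
avoiders123 zero    = [] ∷ []
avoiders123 (suc n) = concatMap (insertions n n) (avoiders123 n)

private
  sum-map-concatMap : (f : B → ℕ) (g : A → List B) (xs : List A) →
    sum (map f (concatMap g xs)) ≡ sum (map (λ x → sum (map f (g x))) xs)
  sum-map-concatMap f g []       = refl
  sum-map-concatMap f g (x ∷ xs) = begin
    sum (map f (g x ++ concatMap g xs))               ≡⟨ cong sum (Listₚ.map-++ f (g x) _) ⟩
    sum (map f (g x) ++ map f (concatMap g xs))       ≡⟨ sum-++ (map f (g x)) _ ⟩
    sum (map f (g x)) + sum (map f (concatMap g xs))  ≡⟨ cong (sum (map f (g x)) +_) (sum-map-concatMap f g xs) ⟩
    sum (map (λ x → sum (map f (g x))) (x ∷ xs))      ∎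
    where open ≡-Reasoning

  -- The ballot recursion unrolled down to height 0: its successive up-steps produce exactly the
  -- labels 1, ..., d+1 of the children.
  ballot-children : ∀ m d → ballot m (suc d) + sum (map (ballot m) (map suc (upTo d))) ≡ ballot (suc m) d
  ballot-children m zero    = +-identityʳ (ballot m 1)
  ballot-children m (suc d) = begin
    ballot m (2 + d) + sum (map (ballot m) (map suc (upTo (suc d))))
      ≡⟨ cong (λ us → ballot m (2 + d) + sum (map (ballot m) (map suc us))) (sym (Listₚ.upTo-∷ʳ d)) ⟩
    ballot m (2 + d) + sum (map (ballot m) (map suc (upTo d List.∷ʳ d)))
      ≡⟨ cong (λ us → ballot m (2 + d) + sum us) (trans (cong (map (ballot m)) (Listₚ.map-++ suc (upTo d) _)) (Listₚ.map-++ (ballot m) (map suc (upTo d)) _)) ⟩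
    ballot m (2 + d) + sum (map (ballot m) (map suc (upTo d)) List.∷ʳ ballot m (suc d))
      ≡⟨ cong (ballot m (2 + d) +_) (sum-++ (map (ballot m) (map suc (upTo d))) _) ⟩
    ballot m (2 + d) + (S + (ballot m (suc d) + 0))
      ≡⟨ cong (λ z → ballot m (2 + d) + (S + z)) (+-identityʳ (ballot m (suc d))) ⟩
    ballot m (2 + d) + (S + ballot m (suc d))
      ≡⟨ +-comm (ballot m (2 + d)) _ ⟩
    S + ballot m (suc d) + ballot m (2 + d)
      ≡⟨ cong (_+ ballot m (2 + d)) (trans (+-comm S _) (ballot-children m d)) ⟩
    ballot (suc m) (suc d) ∎
    where
    open ≡-Reasoning
    S = sum (map (ballot m) (map suc (upTo d)))

  sum-map-1 : (xs : List A) → sum (map (λ _ → 1) xs) ≡ length xs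
  sum-map-1 []       = refl
  sum-map-1 (x ∷ xs) = cong suc (sum-map-1 xs)

-- A node whose decreasing prefix has length d has ballot m d descendants m levels further down.
length-avoiders123-+ : ∀ m n → length (avoiders123 (m + n)) ≡ sum (map (λ w → ballot m (run n w)) (avoiders123 n))
length-avoiders123-+ zero    n = sym (sum-map-1 (avoiders123 n))
length-avoiders123-+ (suc m) n = begin
  length (avoiders123 (suc m + n))
    ≡⟨ cong (length ∘ avoiders123) (sym (+-suc m n)) ⟩
  length (avoiders123 (m + suc n))
    ≡⟨ length-avoiders123-+ m (suc n) ⟩
  sum (map (λ w → ballot m (run (suc n) w)) (concatMap (insertions n n) (avoiders123 n)))
    ≡⟨ sum-map-concatMap (λ w → ballot m (run (suc n) w)) (insertions n n) (avoiders123 n) ⟩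
  sum (map (λ w → sum (map (λ v → ballot m (run (suc n) v)) (insertions n n w))) (avoiders123 n))
    ≡⟨ cong sum (Listₚ.map-cong children (avoiders123 n)) ⟩
  sum (map (λ w → ballot (suc m) (run n w)) (avoiders123 n)) ∎
  where
  open ≡-Reasoning
  children : ∀ w → sum (map (λ v → ballot m (run (suc n) v)) (insertions n n w)) ≡ ballot (suc m) (run n w)
  children w = trans (cong sum (trans (Listₚ.map-∘ (insertions n n w)) (cong (map (ballot m)) (map-run-insert-max n w))))
    (ballot-children m (run n w))

length-avoiders123 : ∀ n → length (avoiders123 n) ≡ Cat n
length-avoiders123 n = begin
  length (avoiders123 n)          ≡⟨ cong (length ∘ avoiders123) (sym (+-identityʳ n)) ⟩
  -- The root of the tree is the empty word, whose label is 0.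
  length (avoiders123 (n + 0))    ≡⟨ length-avoiders123-+ n 0 ⟩
  Cat n + 0                       ≡⟨ +-identityʳ (Cat n) ⟩
  Cat n                           ∎
  where open ≡-Reasoning

insertions-unique : ∀ n w → Unique (insertions n n w)
insertions-unique n w = Uniqueₚ.map⁻ (subst Unique (sym (map-run-insertions w ≤-refl)) (Uniqueₚ.upTo⁺ _))

-- Different parents have disjoint families, because `g` recovers the parent from any member.
concatMap-unique : (f : A → List B) (g : B → A) {xs : List A} → Unique xs → (∀ x → Unique (f x)) →
                   (∀ {x y} → x ∈ xs → y ∈ f x → g y ≡ x) → Unique (concatMap f xs)
concatMap-unique f g []           uf gf = []
concatMap-unique f g {x ∷ xs} (x≢ ∷ u) uf gf = Uniqueₚ.++⁺ (uf x)
  (concatMap-unique f g u uf (gf ∘ there))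
  λ (y∈fx , y∈rest) → let x′ , x′∈xs , y∈fx′ = find (∈-concatMap⁻ f {xs} y∈rest) in
    All.lookup x≢ x′∈xs (trans (sym (gf (here refl) y∈fx)) (gf (there x′∈xs) y∈fx′))

private
  _≢?_ : ∀ n x → Dec (x ≢ n)
  n ≢? x = ¬? (x ℕₚ.≟ n)

  filter-insert : ∀ {n} p q → All (_≢ n) (p ++ q) → filter (n ≢?_) (p ++ n ∷ q) ≡ p ++ q
  filter-insert {n} p q ≢n = begin
    filter (n ≢?_) (p ++ n ∷ q)                   ≡⟨ Listₚ.filter-++ (n ≢?_) p (n ∷ q) ⟩
    filter (n ≢?_) p ++ filter (n ≢?_) (n ∷ q)    ≡⟨ cong₂ _++_ (Listₚ.filter-all (n ≢?_) (Allₚ.++⁻ˡ p ≢n))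
      (trans (Listₚ.filter-reject (n ≢?_) (λ n≢n → n≢n refl)) (Listₚ.filter-all (n ≢?_) (Allₚ.++⁻ʳ p ≢n))) ⟩
    p ++ q                                        ∎
    where open ≡-Reasoning

-- Deleting the largest letter returns the parent, which gives uniqueness. Completeness holds
-- because an ascent before the largest letter would form a 123 with it, so that this letter stands
-- behind a decreasing prefix.
avoiders123-enum : ∀ n → Enumerates (λ w → IsPerm n w × Avoids123 w) (avoiders123 n)
avoiders123-enum zero = record
  { unique   = [] ∷ []
  ; sound    = λ { (here refl) → record { unique = [] ; sound = λ () ; complete = λ () } , λ _ _ _ () }
  ; complete = λ (e , _) → here (empty e)
  }
  where
  empty : ∀ {w} → IsPerm 0 w → w ≡ []
  empty {[]}    e = refl
  empty {x ∷ w} e = contradiction (sound e (here refl)) λ ()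
avoiders123-enum (suc n) = record
  { unique   = concatMap-unique (insertions n n) (filter (n ≢?_)) (unique IH) (insertions-unique n) delete
  ; sound    = sound′
  ; complete = complete′
  }
  where
  IH = avoiders123-enum n

  delete : ∀ {w v} → w ∈ avoiders123 n → v ∈ insertions n n w → filter (n ≢?_) v ≡ w
  delete {w} w∈ v∈ with ∈-insertions⁻ w v∈
  ... | p , q , refl , refl , _ = filter-insert p q (All.tabulate (λ x∈ → <⇒≢ (sound (proj₁ (sound IH w∈)) x∈)))

  sound′ : ∀ {v} → v ∈ avoiders123 (suc n) → IsPerm (suc n) v × Avoids123 v
  sound′ v∈ with find (∈-concatMap⁻ (insertions n n) {avoiders123 n} v∈)
  ... | w , w∈ , v∈′ with ∈-insertions⁻ w v∈′
  ... | p , q , refl , refl , (_ ∷ dec) =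
    let perm , av = sound IH w∈ in
    enum-↭ (↭-sym (shift n p q)) (isPerm-insert perm) ,
    avoids123-insert-max p (λ x∈ → sound perm (∈-++⁺ʳ p x∈)) dec av

  complete′ : ∀ {v} → IsPerm (suc n) v × Avoids123 v → v ∈ avoiders123 (suc n)
  complete′ (perm , av) with ∈-∃++ (complete perm (n<1+n n))
  ... | p , q , refl = ∈-concatMap⁺ (insertions n n) (lose
      (complete IH (perm′ , avoids123-⊆ (Subₚ.++⁺ (⊆-refl {x = p}) (n ∷ʳ ⊆-refl)) av))
      (∈-insertions⁺ p q (All.tabulate (λ x∈ → sound perm′ (∈-++⁺ˡ x∈)) ∷
        ¬ascent⇒decreasing (proj₁ (unique-++⁻ p (unique perm))) λ xy⊆p x<y →
          av _ _ _ (Subₚ.++⁺ xy⊆p (refl ∷ Sub.minimum q)) x<y (sound perm′ (∈-++⁺ˡ (Sub.lookup xy⊆p (there (here refl))))))))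
    where
    perm′ : IsPerm n (p ++ q)
    perm′ = isPerm-delete (enum-↭ (shift n p q) perm)

-- Permutations avoiding 123 with a block of consecutive values

enum-singleton : (a : A) → Enumerates (_≡ a) (a ∷ [])
enum-singleton a = record { unique = [] ∷ [] ; sound = λ { (here refl) → refl } ; complete = here }

-- The head of either list is the maximum of the common set. Identities between decreasing blocks
-- thereby reduce to a comparison of sets.
decreasing-enum-≡ : ∀ {V : ℕ → Set} {xs ys} → Decreasing xs → Decreasing ys →
                    Enumerates V xs → Enumerates V ys → xs ≡ ys
decreasing-enum-≡ dxs dys e f = go dxs dys (complete f ∘ sound e) (complete e ∘ sound f)
  where
  go : ∀ {xs ys} → Decreasing xs → Decreasing ys →
       (∀ {x} → x ∈ xs → x ∈ ys) → (∀ {x} → x ∈ ys → x ∈ xs) → xs ≡ ys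
  go {[]}     {[]}     _  _  _ _ = refl
  go {[]}     {y ∷ ys} _  _  _ g = contradiction (g (here refl)) λ ()
  go {x ∷ xs} {[]}     _  _  f _ = contradiction (f (here refl)) λ ()
  go {x ∷ xs} {y ∷ ys} (x> ∷ dxs) (y> ∷ dys) f g = cong₂ _∷_ x≡y
      (go dxs dys (λ z∈ → tail y (subst (_> _) x≡y (All.lookup x> z∈)) (f (there z∈)))
                  (λ z∈ → tail x (subst (_> _) (sym x≡y) (All.lookup y> z∈)) (g (there z∈))))
    where
    head-≤ : ∀ {a b as} → All (b >_) as → a ∈ b ∷ as → a ≤ b
    head-≤ _  (here refl) = ≤-refl
    head-≤ b> (there a∈)  = <⇒≤ (All.lookup b> a∈)
    x≡y : x ≡ y
    x≡y = ≤-antisym (head-≤ y> (f (here refl))) (head-≤ x> (g (here refl)))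
    tail : ∀ {z as} a → z < a → z ∈ a ∷ as → z ∈ as
    tail a z<a (here refl) = contradiction z<a (<-irrefl refl)
    tail a z<a (there z∈)  = z∈

⊆-map⁻ : ∀ (f : A → B) {s} xs → s ⊆ map f xs → ∃ λ t → s ≡ map f t × t ⊆ xs
⊆-map⁻ f []       []          = [] , refl , []
⊆-map⁻ f (x ∷ xs) (_ ∷ʳ s⊆)   = let t , eq , t⊆ = ⊆-map⁻ f xs s⊆ in t , eq , x ∷ʳ t⊆
⊆-map⁻ f (x ∷ xs) (refl ∷ s⊆) = let t , eq , t⊆ = ⊆-map⁻ f xs s⊆ in x ∷ t , cong (f x ∷_) eq , refl ∷ t⊆

mono⇒reflects-< : ∀ {f : ℕ → ℕ} → (∀ {x y} → x ≤ y → f x ≤ f y) → ∀ {x y} → f x < f y → x < y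
mono⇒reflects-< mono fx<fy = ≰⇒> λ y≤x → <⇒≱ fx<fy (mono y≤x)

-- Only reflection of `<` is asked for, so monotone maps that merge values, such as `collapse`
-- below, are admissible.
avoids123-map : ∀ {f : ℕ → ℕ} {w} → (∀ {x y} → f x < f y → x < y) → Avoids123 w → Avoids123 (map f w)
avoids123-map {f} {w} reflects av _ _ _ xyz⊆ x<y y<z with ⊆-map⁻ f w xyz⊆
... | _ ∷ _ ∷ _ ∷ [] , refl , t⊆ = av _ _ _ t⊆ (reflects x<y) (reflects y<z)

-- An occurrence that crosses the border would contain two successive letters, one on each side, and
-- these descend.
avoids123-skew : ∀ p {q} → (∀ {x y} → x ∈ p → y ∈ q → y < x) → Avoids123 p → Avoids123 q → Avoids123 (p ++ q)
avoids123-skew p q<p avp avq _ _ _ xyz⊆ x<y y<z with ⊆-++⁻ p xyz⊆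
... | []                , _ , refl , _    , s₂⊆q = avq _ _ _ s₂⊆q x<y y<z
... | _ ∷ []            , _ , refl , s₁⊆p , s₂⊆q =
  <-asym x<y (q<p (Sub.lookup s₁⊆p (here refl)) (Sub.lookup s₂⊆q (here refl)))
... | _ ∷ _ ∷ []        , _ , refl , s₁⊆p , s₂⊆q =
  <-asym y<z (q<p (Sub.lookup s₁⊆p (there (here refl))) (Sub.lookup s₂⊆q (here refl)))
... | _ ∷ _ ∷ _ ∷ []    , [] , refl , s₁⊆p , _   = avp _ _ _ s₁⊆p x<y y<z
... | _ ∷ _ ∷ _ ∷ _ ∷ _ , _ , () , _ , _

avoids123-decreasing : ∀ {w} → Decreasing w → Avoids123 w
avoids123-decreasing dec _ _ _ xyz⊆ x<y _ = <-asym x<y (decreasing-⊆ dec (⊆-trans (refl ∷ refl ∷ (_ ∷ʳ [])) xyz⊆))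

decreasing? : Decidable Decreasing
decreasing? = AllPairs.allPairs? ℕₚ._>?_

downFrom-enum : ∀ n → IsPerm n (downFrom n)
downFrom-enum n = record { unique = Uniqueₚ.downFrom⁺ n ; sound = ∈-downFrom⁻ ; complete = ∈-downFrom⁺ }

downFrom-decreasing : ∀ n → Decreasing (downFrom n)
downFrom-decreasing n = AllPairsₚ.applyDownFrom⁺₁ id n (λ j<i _ → j<i)

length-filter-¬ : {P : A → Set} (P? : Decidable P) (xs : List A) →
                  length (filter P? xs) + length (filter (¬? ∘ P?) xs) ≡ length xs
length-filter-¬ P? []       = refl
length-filter-¬ P? (x ∷ xs) with P? x
... | yes _ = cong suc (length-filter-¬ P? xs)
... | no  _ = trans (+-suc _ _) (cong suc (length-filter-¬ P? xs))

length-cartesianProduct : (xs : List A) (ys : List B) → length (cartesianProduct xs ys) ≡ length xs * length ys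
length-cartesianProduct []       ys = refl
length-cartesianProduct (x ∷ xs) ys = trans (Listₚ.length-++ (map (x ,_) ys))
  (cong₂ _+_ (Listₚ.length-map (x ,_) ys) (length-cartesianProduct xs ys))

non-decreasing : ℕ → List (List ℕ)
non-decreasing l = filter (¬? ∘ decreasing?) (avoiders123 l)

-- The one avoider removed is `downFrom l`, the only decreasing permutation.
length-non-decreasing : ∀ l → length (non-decreasing l) ≡ Cat l ∸ 1
length-non-decreasing l = begin
  length (non-decreasing l)              ≡⟨ sym (m+n∸m≡n 1 _) ⟩
  1 + length (non-decreasing l) ∸ 1      ≡⟨ cong (λ d → d + length (non-decreasing l) ∸ 1) (sym one) ⟩
  length (filter decreasing? (avoiders123 l)) + length (non-decreasing l) ∸ 1
                                         ≡⟨ cong (_∸ 1) (trans (length-filter-¬ decreasing? (avoiders123 l)) (length-avoiders123 l)) ⟩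
  Cat l ∸ 1                              ∎
  where
  open ≡-Reasoning
  one : length (filter decreasing? (avoiders123 l)) ≡ 1
  one = enum-length (enum-filter decreasing? (avoiders123-enum l)) (enum-⇔
    (λ { refl → (downFrom-enum l , avoids123-decreasing (downFrom-decreasing l)) , downFrom-decreasing l })
    (λ ((perm , _) , dec) → decreasing-enum-≡ dec (downFrom-decreasing l) perm (downFrom-enum l))
    (enum-singleton (downFrom l)))

InBlock : ℕ → ℕ → ℕ → Set
InBlock κ l x = κ ≤ x × x < κ + l

inBlock? : ∀ κ l → Decidable (InBlock κ l)
inBlock? κ l x = (κ ℕₚ.≤? x) ×-dec (x ℕₚ.<? κ + l)

enum-shift⁺ : ∀ {l w} κ → IsPerm l w → Enumerates (InBlock κ l) (map (_+ κ) w)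
enum-shift⁺ {l} κ = enum-map (_+ κ) (_∸ κ)
  (λ {x} x<l → m≤n+m κ x , subst (x + κ <_) (+-comm l κ) (+-monoˡ-< κ x<l))
  (λ {x} _ → m+n∸n≡m x κ)
  (λ {y} (κ≤y , y<κ+l) → +-cancelʳ-< κ (y ∸ κ) l (subst₂ _<_ (sym (m∸n+n≡m κ≤y)) (+-comm κ l) y<κ+l))
  (λ (κ≤y , _) → m∸n+n≡m κ≤y)

enum-shift⁻ : ∀ {l w} κ → Enumerates (InBlock κ l) w → IsPerm l (map (_∸ κ) w)
enum-shift⁻ {l} κ = enum-map (_∸ κ) (_+ κ)
  (λ {y} (κ≤y , y<κ+l) → +-cancelʳ-< κ (y ∸ κ) l (subst₂ _<_ (sym (m∸n+n≡m κ≤y)) (+-comm κ l) y<κ+l))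
  (λ (κ≤y , _) → m∸n+n≡m κ≤y)
  (λ {x} x<l → m≤n+m κ x , subst (x + κ <_) (+-comm l κ) (+-monoˡ-< κ x<l))
  (λ {x} _ → m+n∸n≡m x κ)

-- The length of the factor `c` is not prescribed: in a word without repetitions it is forced to be
-- `l` by the set of its letters.
HasBlock : ℕ → ℕ → List ℕ → Set
HasBlock κ l w = ∃ λ u → ∃₂ λ c v → w ≡ u ++ c ++ v × (∀ x → x ∈ c ⇔ InBlock κ l x)

-- With values counted from 0: κ = k - 1, l = m + 1, and r values lie above the block.
module Block (κ m r : ℕ) where

  l n N : ℕ
  l = suc m
  n = κ + l + r
  N = κ + suc r

  n≡N+m : n ≡ N + m
  n≡N+m = arith κ m r
    where
    arith : ∀ κ m r → κ + suc m + r ≡ κ + suc r + m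
    arith = solve-∀

  Permutation123 : List ℕ → Set
  Permutation123 w = IsPerm n w × Avoids123 w

  -- Identifies the values of the block with κ and closes the gap.
  collapse : ℕ → ℕ
  collapse y = y ⊓ κ + (y ∸ (κ + m))

  -- A section of `collapse`, whose only value inside the block is the smallest one, κ.
  skip : ℕ → ℕ
  skip x with x ℕₚ.≤? κ
  ... | yes _ = x
  ... | no  _ = x + m

  skip-low : ∀ {x} → x ≤ κ → skip x ≡ x
  skip-low {x} x≤κ with x ℕₚ.≤? κ
  ... | yes _  = refl
  ... | no x≰κ = contradiction x≤κ x≰κ

  skip-high : ∀ {x} → κ < x → skip x ≡ x + m
  skip-high {x} κ<x with x ℕₚ.≤? κ
  ... | yes x≤κ = contradiction x≤κ (<⇒≱ κ<x)
  ... | no _    = refl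

  -- Both summands of the formula are monotone, an advantage over a definition of `collapse` by
  -- cases.
  collapse-mono : ∀ {x y} → x ≤ y → collapse x ≤ collapse y
  collapse-mono x≤y = +-mono-≤ (⊓-monoˡ-≤ κ x≤y) (∸-monoˡ-≤ (κ + m) x≤y)

  collapse-low : ∀ {y} → y ≤ κ → collapse y ≡ y
  collapse-low {y} y≤κ = trans
    (cong₂ _+_ (m≤n⇒m⊓n≡m y≤κ) (m≤n⇒m∸n≡0 (≤-trans y≤κ (m≤m+n κ m)))) (+-identityʳ y)

  collapse-high : ∀ {y} → κ ≤ y → collapse y ≡ κ + (y ∸ (κ + m))
  collapse-high {y} κ≤y = cong (_+ (y ∸ (κ + m))) (m≥n⇒m⊓n≡n κ≤y)

  collapse-block : ∀ {y} → InBlock κ l y → collapse y ≡ κ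
  collapse-block {y} (κ≤y , y<κ+l) = trans (collapse-high κ≤y)
    (trans (cong (κ +_) (m≤n⇒m∸n≡0 (s≤s⁻¹ (subst (y <_) (+-suc κ m) y<κ+l)))) (+-identityʳ κ))

  collapse-above : ∀ {y} → κ + l ≤ y → κ < collapse y
  collapse-above {y} κ+l≤y = subst (κ <_) (sym (collapse-high (≤-trans (m≤m+n κ l) κ+l≤y)))
    (m<m+n κ (m<n⇒0<n∸m (subst (_≤ y) (+-suc κ m) κ+l≤y)))

  collapse≡κ⇒block : ∀ {y} → collapse y ≡ κ → InBlock κ l y
  collapse≡κ⇒block {y} eq =
    ≮⇒≥ (λ y<κ → <⇒≢ y<κ (trans (sym (collapse-low (<⇒≤ y<κ))) eq)) ,
    ≰⇒> (λ κ+l≤y → <⇒≢ (collapse-above κ+l≤y) (sym eq))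

  collapse-skip : ∀ x → collapse (skip x) ≡ x
  collapse-skip x with x ℕₚ.≤? κ
  ... | yes x≤κ = collapse-low x≤κ
  ... | no x≰κ  = let κ≤x = <⇒≤ (≰⇒> x≰κ) in
    trans (collapse-high (≤-trans κ≤x (m≤m+n x m)))
      (trans (cong (κ +_) (trans (cong₂ _∸_ (+-comm x m) (+-comm κ m)) ([m+n]∸[m+o]≡n∸o m x κ)))
        (m+[n∸m]≡n κ≤x))

  skip-collapse : ∀ {y} → ¬ InBlock κ l y → skip (collapse y) ≡ y
  skip-collapse {y} y∉block with y ℕₚ.<? κ
  ... | yes y<κ = trans (cong skip (collapse-low (<⇒≤ y<κ))) (skip-low (<⇒≤ y<κ))
  ... | no y≮κ  = trans (skip-high (collapse-above κ+l≤y))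
      (trans (cong (_+ m) (collapse-high κ≤y)) (trans (shuffle κ (y ∸ (κ + m)) m)
        (m+[n∸m]≡n (≤-trans (+-monoʳ-≤ κ (n≤1+n m)) κ+l≤y))))
    where
    κ≤y = ≮⇒≥ y≮κ
    κ+l≤y : κ + l ≤ y
    κ+l≤y = ≮⇒≥ (λ y<κ+l → y∉block (κ≤y , y<κ+l))
    shuffle : ∀ a b c → a + b + c ≡ a + c + b
    shuffle = solve-∀

  collapse-< : ∀ {y} → y < n → collapse y < N
  collapse-< {y} y<n = +-mono-≤-< (m⊓n≤n y κ)
    (m<n+o⇒m∸n<o y (κ + m) (subst (y <_) (trans (cong (_+ r) (+-suc κ m)) (sym (+-suc (κ + m) r))) y<n))

  skip-< : ∀ {x} → x < N → skip x < n
  skip-< {x} x<N = ≤-<-trans (skip-≤ x) (subst (x + m <_) (sym n≡N+m) (+-monoˡ-< m x<N))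
    where
    skip-≤ : ∀ x → skip x ≤ x + m
    skip-≤ x with x ℕₚ.≤? κ
    ... | yes _ = m≤m+n x m
    ... | no _  = ≤-refl

  -- Decreasing blocks: contraction and inflation

  fibre : ℕ → List ℕ
  fibre x = filter (λ y → collapse y ℕₚ.≟ x) (downFrom n)

  fibre-enum : ∀ x → Enumerates (λ y → y < n × collapse y ≡ x) (fibre x)
  fibre-enum x = enum-filter (λ y → collapse y ℕₚ.≟ x) (downFrom-enum n)

  fibre-decreasing : ∀ x → Decreasing (fibre x)
  fibre-decreasing x = AllPairsₚ.filter⁺ (λ y → collapse y ℕₚ.≟ x) (downFrom-decreasing n)

  block-enum : Enumerates (InBlock κ l) (fibre κ)
  block-enum = enum-⇔ (λ (_ , eq) → collapse≡κ⇒block eq)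
    (λ b → <-≤-trans (proj₂ b) (m≤m+n (κ + l) r) , collapse-block b) (fibre-enum κ)

  -- Inflation replaces each letter by its decreasing fibre: κ becomes the whole block, any other
  -- letter below `N` a single letter. Contraction keeps the values in the image of `skip`, so that
  -- of the block only κ survives, and closes the gap.
  inflate contract : List ℕ → List ℕ
  inflate    = concatMap fibre
  contract w = map collapse (filter (λ y → skip (collapse y) ℕₚ.≟ y) w)

  private
    kept? : ∀ y → Dec (skip (collapse y) ≡ y)
    kept? y = skip (collapse y) ℕₚ.≟ y

  contract-++ : ∀ u v → contract (u ++ v) ≡ contract u ++ contract v
  contract-++ u v = trans (cong (map collapse) (Listₚ.filter-++ kept? u v)) (Listₚ.map-++ collapse (filter kept? u) _)

  contract-fibre : ∀ {x} → x < N → contract (fibre x) ≡ x ∷ []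
  contract-fibre {x} x<N = trans (cong (map collapse) kept-fibre) (cong (_∷ []) (collapse-skip x))
    where
    kept-fibre : filter kept? (fibre x) ≡ skip x ∷ []
    kept-fibre = decreasing-enum-≡ (AllPairsₚ.filter⁺ kept? (fibre-decreasing x)) ([] ∷ [])
      (enum-filter kept? (fibre-enum x))
      (enum-⇔ (λ { refl → (skip-< x<N , collapse-skip x) , cong skip (collapse-skip x) })
              (λ { ((_ , refl) , eq) → sym eq })
              (enum-singleton (skip x)))

  contract-inflate : ∀ {w} → All (_< N) w → contract (inflate w) ≡ w
  contract-inflate []                = refl
  contract-inflate {x ∷ w} (x<N ∷ w<N) = trans (contract-++ (fibre x) (inflate w))
    (cong₂ _++_ (contract-fibre x<N) (contract-inflate w<N))

  fibre-collapse : ∀ {y} → y < n → ¬ InBlock κ l y → fibre (collapse y) ≡ y ∷ []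
  fibre-collapse {y} y<n y∉block = decreasing-enum-≡ (fibre-decreasing (collapse y)) ([] ∷ [])
    (fibre-enum (collapse y))
    (enum-⇔ (λ { refl → y<n , refl }) (λ (_ , eq) → same eq) (enum-singleton y))
    where
    same : ∀ {z} → collapse z ≡ collapse y → z ≡ y
    same {z} eq = trans (sym (skip-collapse (λ z∈block → y∉block (collapse≡κ⇒block (trans (sym eq) (collapse-block z∈block))))))
      (trans (cong skip eq) (skip-collapse y∉block))

  inflate-contract-outside : ∀ {u} → All (_< n) u → All (¬_ ∘ InBlock κ l) u → inflate (contract u) ≡ u
  inflate-contract-outside []          []          = refl
  inflate-contract-outside {y ∷ u} (y<n ∷ u<n) (y∉ ∷ u∉) = trans (cong (inflate ∘ map collapse) (Listₚ.filter-accept kept? (skip-collapse y∉)))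
    (cong₂ _++_ (fibre-collapse y<n y∉) (inflate-contract-outside u<n u∉))

  HasRun : List ℕ → Set
  HasRun w = ∃₂ λ u v → w ≡ u ++ fibre κ ++ v

  HasAscent : List ℕ → Set
  HasAscent w = ∃ λ u → ∃₂ λ c v → w ≡ u ++ c ++ v × Enumerates (InBlock κ l) c × ¬ Decreasing c

  outside : ∀ {u c v} → Unique (u ++ c ++ v) → Enumerates (InBlock κ l) c →
            All (¬_ ∘ InBlock κ l) u × All (¬_ ∘ InBlock κ l) v
  outside {u} {c} {v} uniq e =
    let _ , uniq′ , u#cv = unique-++⁻ u uniq
        _ , _ , c#v      = unique-++⁻ c uniq′ in
    All.tabulate (λ x∈u x∈block → u#cv (x∈u , ∈-++⁺ˡ (complete e x∈block))) ,
    All.tabulate (λ x∈v x∈block → c#v (complete e x∈block , x∈v))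

  filter-block : ∀ {u c v} → Unique (u ++ c ++ v) → Enumerates (InBlock κ l) c →
                 filter (inBlock? κ l) (u ++ c ++ v) ≡ c
  filter-block {u} {c} {v} uniq e = let u∉ , v∉ = outside {u} {c} uniq e in begin
    filter b? (u ++ c ++ v)                       ≡⟨ Listₚ.filter-++ b? u (c ++ v) ⟩
    filter b? u ++ filter b? (c ++ v)             ≡⟨ cong₂ _++_ (Listₚ.filter-none b? u∉) (Listₚ.filter-++ b? c v) ⟩
    filter b? c ++ filter b? v                    ≡⟨ cong₂ _++_ (Listₚ.filter-all b? (All.tabulate (sound e))) (Listₚ.filter-none b? v∉) ⟩
    c ++ []                                       ≡⟨ Listₚ.++-identityʳ c ⟩
    c                                             ∎
    where
    open ≡-Reasoning
    b? = inBlock? κ l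

  -- Filtering by the block recovers the cluster from the word alone, whatever the factorization, so
  -- it cannot be both decreasing and not decreasing.
  run#ascent : ∀ {w} → Unique w → HasRun w → HasAscent w → ⊥
  run#ascent uniq (u , v , refl) (u′ , c , v′ , eq , e , ¬dec) = ¬dec (subst Decreasing
    (trans (sym (filter-block {u} uniq block-enum))
      (trans (cong (filter (inBlock? κ l)) eq) (filter-block {u′} (subst Unique eq uniq) e)))
    (fibre-decreasing κ))

  hasRun⇒hasBlock : ∀ {w} → HasRun w → HasBlock κ l w
  hasRun⇒hasBlock (u , v , eq) = u , fibre κ , v , eq , λ x → mk⇔ (sound block-enum) (complete block-enum)

  hasAscent⇒hasBlock : ∀ {w} → HasAscent w → HasBlock κ l w
  hasAscent⇒hasBlock (u , c , v , eq , e , _) = u , c , v , eq , λ x → mk⇔ (sound e) (complete e)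

  hasBlock⇒ : ∀ {w} → Unique w → HasBlock κ l w → HasRun w ⊎ HasAscent w
  hasBlock⇒ uniq (u , c , v , refl , iff) = byCases (decreasing? c)
    where
    c-enum : Enumerates (InBlock κ l) c
    c-enum = record
      { unique   = proj₁ (unique-++⁻ c (proj₁ (proj₂ (unique-++⁻ u uniq))))
      ; sound    = Equivalence.to (iff _)
      ; complete = Equivalence.from (iff _)
      }
    byCases : Dec (Decreasing c) → HasRun (u ++ c ++ v) ⊎ HasAscent (u ++ c ++ v)
    byCases (yes dec) = inj₁ (u , v , cong (λ c → u ++ c ++ v) (decreasing-enum-≡ dec (fibre-decreasing κ) c-enum block-enum))
    byCases (no ¬dec) = inj₂ (u , c , v , refl , c-enum , ¬dec)

  inflate-contract : ∀ {w} → IsPerm n w → HasRun w → inflate (contract w) ≡ w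
  inflate-contract perm (u , v , refl) = begin
    inflate (contract (u ++ fibre κ ++ v))
      ≡⟨ cong inflate (trans (contract-++ u _) (cong (contract u ++_) (contract-++ (fibre κ) v))) ⟩
    inflate (contract u ++ contract (fibre κ) ++ contract v)
      ≡⟨ cong (λ c → inflate (contract u ++ c ++ contract v)) (contract-fibre (m<m+n κ (s≤s z≤n))) ⟩
    inflate (contract u ++ κ ∷ contract v)
      ≡⟨ Listₚ.concatMap-++ fibre (contract u) (κ ∷ contract v) ⟩
    inflate (contract u) ++ fibre κ ++ inflate (contract v)
      ≡⟨ cong₂ (λ u v → u ++ fibre κ ++ v) (inflate-contract-outside u<n u∉) (inflate-contract-outside v<n v∉) ⟩
    u ++ fibre κ ++ v ∎
    where
    open ≡-Reasoning
    <n : All (_< n) (u ++ fibre κ ++ v)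
    <n = All.tabulate (sound perm)
    u<n = Allₚ.++⁻ˡ u <n
    v<n = Allₚ.++⁻ʳ (fibre κ) (Allₚ.++⁻ʳ u <n)
    u∉ = proj₁ (outside {u} (unique perm) block-enum)
    v∉ = proj₂ (outside {u} (unique perm) block-enum)

  contract-isPerm : ∀ {w} → IsPerm n w → IsPerm N (contract w)
  contract-isPerm perm = enum-map collapse skip (λ (y<n , _) → collapse-< y<n) proj₂
    (λ {x} x<N → skip-< x<N , cong skip (collapse-skip x)) (λ {x} _ → collapse-skip x)
    (enum-filter kept? perm)

  contract-avoids : ∀ {w} → Avoids123 w → Avoids123 (contract w)
  contract-avoids {w} av = avoids123-map (mono⇒reflects-< collapse-mono) (avoids123-⊆ (Subₚ.filter-⊆ kept? w) av)

  private
    fibre-∈ : ∀ {x y} → y ∈ fibre x → collapse y ≡ x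
    fibre-∈ {x} = proj₂ ∘ sound (fibre-enum x)

    inflate-∈ : ∀ {y} w → y ∈ inflate w → collapse y ∈ w
    inflate-∈ {y} w y∈ = let x , x∈w , y∈x = find (∈-concatMap⁻ fibre {w} y∈) in subst (_∈ w) (sym (fibre-∈ y∈x)) x∈w

  inflate-isPerm : ∀ {w} → IsPerm N w → IsPerm n (inflate w)
  inflate-isPerm {w} perm = record
    { unique   = concatMap-unique fibre collapse (unique perm) (λ x → unique (fibre-enum x)) (λ _ → fibre-∈)
    ; sound    = λ y∈ → let x , _ , y∈x = find (∈-concatMap⁻ fibre {w} y∈) in proj₁ (sound (fibre-enum x) y∈x)
    ; complete = λ y<n → ∈-concatMap⁺ fibre (lose (complete perm (collapse-< y<n)) (complete (fibre-enum _) (y<n , refl)))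
    }

  -- As the letters of `w` are distinct, letters of equal collapse come from one and the same fibre,
  -- which is decreasing.
  inflate-descent : ∀ {x y w} → Unique w → x ∷ y ∷ [] ⊆ inflate w → collapse x ≡ collapse y → y < x
  inflate-descent {w = a ∷ w} (a≢ ∷ uniq) xy⊆ eq with ⊆-++⁻ (fibre a) xy⊆
  ... | []             , _  , refl , _   , s⊆ = inflate-descent uniq s⊆ eq
  ... | _ ∷ []         , _  , refl , s⊆a , s⊆ = contradiction
    (trans (sym (fibre-∈ (Sub.lookup s⊆a (here refl)))) eq)
    (All.lookup a≢ (inflate-∈ w (Sub.lookup s⊆ (here refl))))
  ... | _ ∷ _ ∷ []     , [] , refl , s⊆a , _  = decreasing-⊆ (fibre-decreasing a) s⊆a
  ... | _ ∷ _ ∷ _ ∷ _  , _  , ()   , _   , _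

  -- With distinct images, at most one letter is taken from each fibre, so the sublist projects to a
  -- sublist of `w`.
  map-collapse-⊆ : ∀ {s} w → Unique (map collapse s) → s ⊆ inflate w → map collapse s ⊆ w
  map-collapse-⊆ {[]}    []      _    []  = []
  map-collapse-⊆ {s}     (a ∷ w) uniq s⊆ with ⊆-++⁻ (fibre a) s⊆
  ... | []         , _  , refl , _   , s₂⊆ = a ∷ʳ map-collapse-⊆ w uniq s₂⊆
  ... | _ ∷ []     , s₂ , refl , s₁⊆ , s₂⊆ = fibre-∈ (Sub.lookup s₁⊆ (here refl)) ∷ map-collapse-⊆ w (AllPairs.tail uniq) s₂⊆
  ... | _ ∷ _ ∷ _  , s₂ , refl , s₁⊆ , s₂⊆ = contradiction
    (trans (fibre-∈ (Sub.lookup s₁⊆ (here refl))) (sym (fibre-∈ (Sub.lookup s₁⊆ (there (here refl))))))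
    (All.head (AllPairs.head uniq))

  -- No ascent lies within a fibre, so each ascent of the inflated word stays strict under
  -- `collapse` and a 123 would project to a 123 in `w`.
  inflate-avoids : ∀ {w} → Unique w → Avoids123 w → Avoids123 (inflate w)
  inflate-avoids {w} uniq av x y z xyz⊆ x<y y<z = av _ _ _
      (map-collapse-⊆ w ((<⇒≢ cx<cy ∷ <⇒≢ (<-trans cx<cy cy<cz) ∷ []) ∷ (<⇒≢ cy<cz ∷ []) ∷ [] ∷ []) xyz⊆)
      cx<cy cy<cz
    where
    strict : ∀ {x y} → x < y → x ∷ y ∷ [] ⊆ inflate w → collapse x < collapse y
    strict x<y xy⊆ = ≤∧≢⇒< (collapse-mono (<⇒≤ x<y)) (λ eq → <-asym x<y (inflate-descent uniq xy⊆ eq))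
    cx<cy = strict x<y (⊆-trans (refl ∷ refl ∷ (z ∷ʳ [])) xyz⊆)
    cy<cz = strict y<z (⊆-trans (x ∷ʳ refl ∷ refl ∷ []) xyz⊆)

  inflate-hasRun : ∀ {w} → IsPerm N w → HasRun (inflate w)
  inflate-hasRun perm with ∈-∃++ (complete perm (m<m+n κ (s≤s z≤n)))
  ... | u , v , refl = inflate u , inflate v , Listₚ.concatMap-++ fibre u (κ ∷ v)

  run-enum : Enumerates (λ w → Permutation123 w × HasRun w) (map inflate (avoiders123 N))
  run-enum = enum-map inflate contract
    (λ (perm , av) → (inflate-isPerm perm , inflate-avoids (unique perm) av) , inflate-hasRun perm)
    (λ (perm , _) → contract-inflate (All.tabulate (sound perm)))
    (λ ((perm , av) , _) → contract-isPerm perm , contract-avoids av)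
    (λ ((perm , _) , hasRun) → inflate-contract perm hasRun)
    (avoiders123-enum N)

  -- Blocks with an ascent: skew sums

  skew : (List ℕ × List ℕ) × List ℕ → List ℕ
  skew ((u , c) , v) = map (_+ (κ + l)) u ++ map (_+ κ) c ++ v

  private
    above? : ∀ x → Dec (κ + l ≤ x)
    above? x = κ + l ℕₚ.≤? x
    below? : ∀ x → Dec (x < κ)
    below? x = x ℕₚ.<? κ
    b? = inBlock? κ l

  -- The three layers are extracted by value, so no factorization has to be supplied. This inverts
  -- `skew` precisely because the layers of the words concerned also follow one another in position.
  unskew : List ℕ → (List ℕ × List ℕ) × List ℕ
  unskew w = (map (_∸ (κ + l)) (filter above? w) , map (_∸ κ) (filter b? w)) , filter below? w

  Layered : List ℕ → List ℕ → List ℕ → Set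
  Layered u c v = All (κ + l ≤_) u × All (InBlock κ l) c × All (_< κ) v

  private
    filter-++₃ : ∀ {P : ℕ → Set} (P? : Decidable P) u c v →
                 filter P? (u ++ c ++ v) ≡ filter P? u ++ filter P? c ++ filter P? v
    filter-++₃ P? u c v = trans (Listₚ.filter-++ P? u _) (cong (filter P? u ++_) (Listₚ.filter-++ P? c v))

    κ≤κ+l : κ ≤ κ + l
    κ≤κ+l = m≤m+n κ l

  layered-filter : ∀ {u c v} → Layered u c v →
    filter above? (u ++ c ++ v) ≡ u × filter b? (u ++ c ++ v) ≡ c × filter below? (u ++ c ++ v) ≡ v
  layered-filter {u} {c} {v} (u≥ , c∈ , v<) =
    trans (filter-++₃ above? u c v) (trans (cong₂ _++_ (Listₚ.filter-all above? u≥) (cong₂ _++_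
      (Listₚ.filter-none above? (All.map (<⇒≱ ∘ proj₂) c∈))
      (Listₚ.filter-none above? (All.map (λ x<κ → <⇒≱ (<-≤-trans x<κ κ≤κ+l)) v<)))) (Listₚ.++-identityʳ u)) ,
    trans (filter-++₃ b? u c v) (trans (cong₂ _++_
      (Listₚ.filter-none b? (All.map (λ κ+l≤x (_ , x<) → <⇒≱ x< κ+l≤x) u≥)) (cong₂ _++_
      (Listₚ.filter-all b? c∈)
      (Listₚ.filter-none b? (All.map (λ x<κ (κ≤x , _) → <⇒≱ x<κ κ≤x) v<)))) (Listₚ.++-identityʳ c)) ,
    trans (filter-++₃ below? u c v) (cong₂ _++_
      (Listₚ.filter-none below? (All.map (λ κ+l≤x x<κ → <⇒≱ x<κ (≤-trans κ≤κ+l κ+l≤x)) u≥)) (cong₂ _++_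
      (Listₚ.filter-none below? (All.map (λ (κ≤x , _) x<κ → <⇒≱ x<κ κ≤x) c∈))
      (Listₚ.filter-all below? v<)))

  private
    map-+-∸ : ∀ a {u} → All (a ≤_) u → map (_+ a) (map (_∸ a) u) ≡ u
    map-+-∸ a {u} u≥ = trans (sym (Listₚ.map-∘ u)) (Listₚ.map-id-local (All.map m∸n+n≡m u≥))

    map-∸-+ : ∀ a u → map (_∸ a) (map (_+ a) u) ≡ u
    map-∸-+ a u = trans (sym (Listₚ.map-∘ u)) (Listₚ.map-id-local (All.universal (λ x → m+n∸n≡m x a) u))

  -- An ascent inside the block excludes smaller values before it and larger values after it.
  ascent-layered : ∀ {u c v} → Permutation123 (u ++ c ++ v) → Enumerates (InBlock κ l) c → ¬ Decreasing c → Layered u c v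
  ascent-layered {u} {c} {v} (perm , av) e ¬dec =
      All.tabulate (λ x∈u → above (All.lookup u∉ x∈u) (λ x<κ → before x∈u x<κ)) ,
      All.tabulate (sound e) ,
      All.tabulate (λ x∈v → below (All.lookup v∉ x∈v) (λ κ+l≤x → after x∈v κ+l≤x))
    where
    u∉ = proj₁ (outside {u} (unique perm) e)
    v∉ = proj₂ (outside {u} (unique perm) e)
    above : ∀ {x} → ¬ InBlock κ l x → ¬ x < κ → κ + l ≤ x
    above x∉ x≮κ = ≮⇒≥ (λ x< → x∉ (≮⇒≥ x≮κ , x<))
    below : ∀ {x} → ¬ InBlock κ l x → ¬ κ + l ≤ x → x < κ
    below x∉ κ+l≰x = ≰⇒> (λ κ≤x → x∉ (κ≤x , ≰⇒> κ+l≰x))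
    before : ∀ {x} → x ∈ u → ¬ x < κ
    before x∈u x<κ = ¬dec (¬ascent⇒decreasing (unique e) λ yz⊆c y<z →
      av _ _ _ (Subₚ.++⁺ (from∈ x∈u) (Subₚ.++⁺ yz⊆c (Sub.minimum v)))
        (<-≤-trans x<κ (proj₁ (sound e (Sub.lookup yz⊆c (here refl))))) y<z)
    after : ∀ {x} → x ∈ v → ¬ κ + l ≤ x
    after x∈v κ+l≤x = ¬dec (¬ascent⇒decreasing (unique e) λ yz⊆c y<z →
      av _ _ _ (Subₚ.++⁺ (Sub.minimum u) (Subₚ.++⁺ yz⊆c (from∈ x∈v)))
        y<z (<-≤-trans (proj₂ (sound e (Sub.lookup yz⊆c (there (here refl))))) κ+l≤x))

  Parts : (List ℕ × List ℕ) × List ℕ → Set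
  Parts ((u , c) , v) =
    ((IsPerm r u × Avoids123 u) × ((IsPerm l c × Avoids123 c) × ¬ Decreasing c)) × (IsPerm κ v × Avoids123 v)

  skew-layered : ∀ {u c v} → IsPerm r u → IsPerm l c → IsPerm κ v → Layered (map (_+ (κ + l)) u) (map (_+ κ) c) v
  skew-layered pu pc pv =
    All.tabulate (proj₁ ∘ sound (enum-shift⁺ (κ + l) pu)) ,
    All.tabulate (sound (enum-shift⁺ κ pc)) ,
    All.tabulate (sound pv)

  private
    +-reflects-< : ∀ a {x y} → x + a < y + a → x < y
    +-reflects-< a {x} {y} = +-cancelʳ-< a x y

  skew-ascent : ∀ {t} → Parts t → Permutation123 (skew t) × HasAscent (skew t)
  skew-ascent {(u , c) , v} (((pu , avu) , ((pc , avc) , ¬dec)) , (pv , avv)) =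
      ( enum-⇔ to from (enum-++ uᴱ (enum-++ cᴱ pv c#v) u#cv)
      , avoids123-skew u′ (λ x∈ y∈ → u>cv (sound uᴱ x∈) ([ inj₁ ∘ sound cᴱ , inj₂ ∘ sound pv ]′ (∈-++⁻ c′ y∈)))
          (avoids123-map (+-reflects-< (κ + l)) avu)
          (avoids123-skew c′ (λ x∈ y∈ → <-≤-trans (sound pv y∈) (proj₁ (sound cᴱ x∈)))
            (avoids123-map (+-reflects-< κ) avc) avv) ) ,
      u′ , c′ , v , refl , cᴱ ,
      λ dec → ¬dec (AllPairs.map (λ {x} {y} → +-cancelʳ-< κ y x) (AllPairsₚ.map⁻ dec))
    where
    u′ = map (_+ (κ + l)) u
    c′ = map (_+ κ) c
    uᴱ = enum-shift⁺ (κ + l) pu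
    cᴱ = enum-shift⁺ κ pc
    u>cv : ∀ {x y} → InBlock (κ + l) r x → InBlock κ l y ⊎ y < κ → y < x
    u>cv (κ+l≤x , _) (inj₁ (_ , y<κ+l)) = <-≤-trans y<κ+l κ+l≤x
    u>cv (κ+l≤x , _) (inj₂ y<κ)         = <-≤-trans y<κ (≤-trans κ≤κ+l κ+l≤x)
    c#v : ∀ {x} → InBlock κ l x → x < κ → ⊥
    c#v (κ≤x , _) x<κ = <⇒≱ x<κ κ≤x
    u#cv : ∀ {x} → InBlock (κ + l) r x → InBlock κ l x ⊎ x < κ → ⊥
    u#cv x∈ x∈′ = <-irrefl refl (u>cv x∈ x∈′)
    to : ∀ {x} → InBlock (κ + l) r x ⊎ (InBlock κ l x ⊎ x < κ) → x < n
    to (inj₁ (_ , x<n))          = x<n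
    to (inj₂ (inj₁ (_ , x<κ+l))) = <-≤-trans x<κ+l (m≤m+n (κ + l) r)
    to (inj₂ (inj₂ x<κ))         = <-≤-trans x<κ (≤-trans κ≤κ+l (m≤m+n (κ + l) r))
    from : ∀ {x} → x < n → InBlock (κ + l) r x ⊎ (InBlock κ l x ⊎ x < κ)
    from {x} x<n with x ℕₚ.<? κ | x ℕₚ.<? κ + l
    ... | yes x<κ | _         = inj₂ (inj₂ x<κ)
    ... | no x≮κ  | yes x<κ+l = inj₂ (inj₁ (≮⇒≥ x≮κ , x<κ+l))
    ... | no _    | no x≮κ+l  = inj₁ (≮⇒≥ x≮κ+l , x<n)

  unskew-skew : ∀ {t} → Parts t → unskew (skew t) ≡ t
  unskew-skew {(u , c) , v} (((pu , _) , ((pc , _) , _)) , (pv , _)) =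
    let equ , eqc , eqv = layered-filter (skew-layered pu pc pv) in
    cong₂ _,_ (cong₂ _,_ (trans (cong (map (_∸ (κ + l))) equ) (map-∸-+ (κ + l) u))
                         (trans (cong (map (_∸ κ)) eqc) (map-∸-+ κ c))) eqv

  unskew-parts : ∀ {w} → Permutation123 w × HasAscent w → Parts (unskew w)
  unskew-parts {w} ((perm , av) , (u , c , v , refl , e , ¬dec)) =
    ( ( enum-shift⁻ (κ + l) (enum-⇔ (λ (x<n , κ+l≤x) → κ+l≤x , x<n) (λ (κ+l≤x , x<n) → x<n , κ+l≤x) (enum-filter above? perm))
      , avoids123-map (mono⇒reflects-< (∸-monoˡ-≤ (κ + l))) (avoids123-⊆ (Subₚ.filter-⊆ above? w) av) )
    , ( ( enum-shift⁻ κ (enum-⇔ proj₂ (λ x∈ → <-≤-trans (proj₂ x∈) (m≤m+n (κ + l) r) , x∈) (enum-filter b? perm))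
        , avoids123-map (mono⇒reflects-< (∸-monoˡ-≤ κ)) (avoids123-⊆ (Subₚ.filter-⊆ b? w) av) )
      , λ dec → ¬dec (subst Decreasing (filter-block {u} (unique perm) e)
          (AllPairs.map (λ {x} {y} → mono⇒reflects-< (∸-monoˡ-≤ κ) {y} {x}) (AllPairsₚ.map⁻ dec)) ) ) )
    , ( enum-⇔ proj₂ (λ x<κ → <-≤-trans x<κ (≤-trans κ≤κ+l (m≤m+n (κ + l) r)) , x<κ) (enum-filter below? perm)
      , avoids123-⊆ (Subₚ.filter-⊆ below? w) av )

  skew-unskew : ∀ {w} → Permutation123 w × HasAscent w → skew (unskew w) ≡ w
  skew-unskew (perm123 , (u , c , v , refl , e , ¬dec)) =
    let layers@(u≥ , c∈ , _) = ascent-layered {u} perm123 e ¬dec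
        equ , eqc , eqv      = layered-filter layers in
    cong₂ _++_ (trans (cong (map (_+ (κ + l)) ∘ map (_∸ (κ + l))) equ) (map-+-∸ (κ + l) u≥))
      (cong₂ _++_ (trans (cong (map (_+ κ) ∘ map (_∸ κ)) eqc) (map-+-∸ κ (All.map proj₁ c∈))) eqv)

  parts : List ((List ℕ × List ℕ) × List ℕ)
  parts = cartesianProduct (cartesianProduct (avoiders123 r) (non-decreasing l)) (avoiders123 κ)

  ascent-enum : Enumerates (λ w → Permutation123 w × HasAscent w) (map skew parts)
  ascent-enum = enum-map skew unskew skew-ascent unskew-skew unskew-parts skew-unskew
    (enum-× (enum-× (avoiders123-enum r) (enum-filter (¬? ∘ decreasing?) (avoiders123-enum l))) (avoiders123-enum κ))

  block-count : ∀ {ws} → Enumerates (λ w → Permutation123 w × HasBlock κ l w) ws →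
                length ws ≡ Cat N + Cat κ * (Cat l ∸ 1) * Cat r
  block-count {ws} ws-enum = begin
    length ws
      ≡⟨ enum-length ws-enum (enum-⇔ to from (enum-++ run-enum ascent-enum disjoint)) ⟩
    length (map inflate (avoiders123 N) ++ map skew parts)
      ≡⟨ Listₚ.length-++ (map inflate (avoiders123 N)) ⟩
    length (map inflate (avoiders123 N)) + length (map skew parts)
      ≡⟨ cong₂ _+_ (trans (Listₚ.length-map inflate (avoiders123 N)) (length-avoiders123 N)) (Listₚ.length-map skew parts) ⟩
    Cat N + length parts
      ≡⟨ cong (Cat N +_) length-parts ⟩
    Cat N + Cat r * (Cat l ∸ 1) * Cat κ
      ≡⟨ cong (Cat N +_) (shuffle (Cat r) (Cat l ∸ 1) (Cat κ)) ⟩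
    Cat N + Cat κ * (Cat l ∸ 1) * Cat r ∎
    where
    open ≡-Reasoning
    shuffle : ∀ a b c → a * b * c ≡ c * b * a
    shuffle = solve-∀
    length-parts : length parts ≡ Cat r * (Cat l ∸ 1) * Cat κ
    length-parts = trans (length-cartesianProduct (cartesianProduct (avoiders123 r) (non-decreasing l)) (avoiders123 κ))
      (cong₂ _*_ (trans (length-cartesianProduct (avoiders123 r) (non-decreasing l))
        (cong₂ _*_ (length-avoiders123 r) (length-non-decreasing l))) (length-avoiders123 κ))
    disjoint : ∀ {w} → Permutation123 w × HasRun w → Permutation123 w × HasAscent w → ⊥
    disjoint ((perm , _) , hasRun) (_ , hasAscent) = run#ascent (unique perm) hasRun hasAscent
    to : ∀ {w} → (Permutation123 w × HasRun w) ⊎ (Permutation123 w × HasAscent w) → Permutation123 w × HasBlock κ l w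
    to (inj₁ (perm , hasRun))    = perm , hasRun⇒hasBlock hasRun
    to (inj₂ (perm , hasAscent)) = perm , hasAscent⇒hasBlock hasAscent
    from : ∀ {w} → Permutation123 w × HasBlock κ l w → (Permutation123 w × HasRun w) ⊎ (Permutation123 w × HasAscent w)
    from (perm , hasBlock) = [ (λ hasRun → inj₁ (perm , hasRun)) , (λ hasAscent → inj₂ (perm , hasAscent)) ]′
      (hasBlock⇒ (unique (proj₁ perm)) hasBlock)

-- Encoding words by lists

private
  variable
    m n : ℕ

-- In contrast to `enum-map`, no inverse function is required: a list is decoded into a word only
-- together with a proof that it is a permutation.
enum-image : {V : A → Set} {W : B → Set} {xs : List A} (f : A → B) → (∀ {x y} → f x ≡ f y → x ≡ y) →
             (∀ {x} → V x → W (f x)) → (∀ {y} → W y → ∃ λ x → V x × f x ≡ y) →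
             Enumerates V xs → Enumerates W (map f xs)
enum-image {W = W} {xs} f injective Wf preimage e = record
  { unique   = Uniqueₚ.map⁺ injective (unique e)
  ; sound    = λ y∈ → let x , x∈xs , y≡fx = ∈-map⁻ f y∈ in subst W (sym y≡fx) (Wf (sound e x∈xs))
  ; complete = λ Wy → let x , Vx , fx≡y = preimage Wy in subst (_∈ map f xs) fx≡y (∈-map⁺ f (complete e Vx))
  }

code : Vec (Fin n) m → List ℕ
code v = Vec.toList (Vec.map toℕ v)

code-injective : (u v : Vec (Fin n) m) → code u ≡ code v → u ≡ v
code-injective []      []      _  = refl
code-injective (i ∷ u) (j ∷ v) eq =
  cong₂ _∷_ (Finₚ.toℕ-injective (Listₚ.∷-injectiveˡ eq)) (code-injective u v (Listₚ.∷-injectiveʳ eq))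

length-code : (v : Vec (Fin n) m) → length (code v) ≡ m
length-code []      = refl
length-code (i ∷ v) = cong suc (length-code v)

decode : ∀ w → All (_< n) w → length w ≡ m → ∃ λ (v : Vec (Fin n) m) → code v ≡ w
decode []      []           refl = [] , refl
decode (x ∷ w) (x<n ∷ w<n) refl = let v , eq = decode w w<n refl in
  fromℕ< x<n ∷ v , cong₂ _∷_ (Finₚ.toℕ-fromℕ< x<n) eq

∈-code⁺ : (v : Vec (Fin n) m) (i : Fin m) → toℕ (lookup v i) ∈ code v
∈-code⁺ (_ ∷ v) zero    = here refl
∈-code⁺ (_ ∷ v) (suc i) = there (∈-code⁺ v i)

∈-code⁻ : ∀ {x} (v : Vec (Fin n) m) → x ∈ code v → ∃ λ i → toℕ (lookup v i) ≡ x
∈-code⁻ (_ ∷ v) (here refl) = zero , refl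
∈-code⁻ (_ ∷ v) (there x∈)  = let i , eq = ∈-code⁻ v x∈ in suc i , eq

code-unique : (v : Vec (Fin n) m) → Injective _≡_ _≡_ (lookup v) → Unique (code v)
code-unique []      _   = []
code-unique (a ∷ v) inj = All.tabulate fresh ∷ code-unique v (Finₚ.suc-injective ∘ inj)
  where
  fresh : ∀ {x} → x ∈ code v → toℕ a ≢ x
  fresh x∈ refl = let i , eq = ∈-code⁻ v x∈ in contradiction (inj {zero} {suc i} (Finₚ.toℕ-injective (sym eq))) λ ()

lookup-injective : (v : Vec (Fin n) m) → Unique (code v) → Injective _≡_ _≡_ (lookup v)
lookup-injective (a ∷ v) (a≢ ∷ u) {zero}  {zero}  _  = refl
lookup-injective (a ∷ v) (a≢ ∷ u) {zero}  {suc j} eq = contradiction (cong toℕ eq) (All.lookup a≢ (∈-code⁺ v j))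
lookup-injective (a ∷ v) (a≢ ∷ u) {suc i} {zero}  eq = contradiction (cong toℕ (sym eq)) (All.lookup a≢ (∈-code⁺ v i))
lookup-injective (a ∷ v) (a≢ ∷ u) {suc i} {suc j} eq = cong suc (lookup-injective v u eq)

isPermutation⇒isPerm : (σ : Word n) → IsPermutation σ → IsPerm n (code σ)
isPermutation⇒isPerm σ (inj , surj) = record
  { unique   = code-unique σ inj
  ; sound    = λ x∈ → let i , eq = ∈-code⁻ σ x∈ in subst (_< _) eq (Finₚ.toℕ<n (lookup σ i))
  ; complete = λ x<n → let i , eq = surjective⇒strictlySurjective surj (fromℕ< x<n) in
      subst (_∈ code σ) (trans (cong toℕ eq) (Finₚ.toℕ-fromℕ< x<n)) (∈-code⁺ σ i)
  }

isPerm⇒isPermutation : (σ : Word n) → IsPerm n (code σ) → IsPermutation σ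
isPerm⇒isPermutation σ perm = lookup-injective σ (unique perm) , strictlySurjective⇒surjective
  (λ y → let i , eq = ∈-code⁻ σ (complete perm (Finₚ.toℕ<n y)) in i , Finₚ.toℕ-injective eq)

isPerm-length : ∀ {w} → IsPerm n w → length w ≡ n
isPerm-length {n} perm = trans (enum-length perm (downFrom-enum n)) (Listₚ.length-downFrom n)

isPerm-decode : ∀ {w} → IsPerm n w → ∃ λ (σ : Word n) → IsPermutation σ × code σ ≡ w
isPerm-decode {w = w} perm with decode w (All.tabulate (sound perm)) (isPerm-length perm)
... | σ , refl = σ , isPerm⇒isPermutation σ perm , refl

-- Pattern occurrences as sublists

code-⊆₂ : (v : Vec (Fin n) m) {i j : Fin m} → i Fin.< j →
          toℕ (lookup v i) ∷ toℕ (lookup v j) ∷ [] ⊆ code v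
code-⊆₂ (x ∷ v) {zero}  {suc j} _   = refl ∷ from∈ (∈-code⁺ v j)
code-⊆₂ (x ∷ v) {suc i} {suc j} i<j = toℕ x ∷ʳ code-⊆₂ v (s≤s⁻¹ i<j)

code-⊆₃ : (v : Vec (Fin n) m) {i j k : Fin m} → i Fin.< j → j Fin.< k →
          toℕ (lookup v i) ∷ toℕ (lookup v j) ∷ toℕ (lookup v k) ∷ [] ⊆ code v
code-⊆₃ (x ∷ v) {zero}  {suc j} {suc k} _   j<k = refl ∷ code-⊆₂ v (s≤s⁻¹ j<k)
code-⊆₃ (x ∷ v) {suc i} {suc j} {suc k} i<j j<k = toℕ x ∷ʳ code-⊆₃ v (s≤s⁻¹ i<j) (s≤s⁻¹ j<k)

code-⊆⁻ : ∀ {s} (v : Vec (Fin n) m) → s ⊆ code v →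
          ∃ λ is → AllPairs Fin._<_ is × s ≡ map (toℕ ∘ lookup v) is
code-⊆⁻ []      []          = [] , [] , refl
code-⊆⁻ (x ∷ v) (_ ∷ʳ s⊆)   = let is , inc , eq = code-⊆⁻ v s⊆ in
  map suc is , AllPairsₚ.map⁺ (AllPairs.map s≤s inc) , trans eq (Listₚ.map-∘ is)
code-⊆⁻ (x ∷ v) (refl ∷ s⊆) = let is , inc , eq = code-⊆⁻ v s⊆ in
  zero ∷ map suc is , Allₚ.map⁺ (All.universal (λ _ → s≤s z≤n) is) ∷ AllPairsₚ.map⁺ (AllPairs.map s≤s inc) ,
  cong (toℕ x ∷_) (trans eq (Listₚ.map-∘ is))

on-pairs : {R : Fin 3 → Fin 3 → Set} → R zero (suc zero) → R (suc zero) (suc (suc zero)) → R zero (suc (suc zero)) →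
           ∀ j j′ → j Fin.< j′ → R j j′
on-pairs r₀₁ r₁₂ r₀₂ zero          (suc zero)       _ = r₀₁
on-pairs r₀₁ r₁₂ r₀₂ zero          (suc (suc zero)) _ = r₀₂
on-pairs r₀₁ r₁₂ r₀₂ (suc zero)    (suc (suc zero)) _ = r₁₂
on-pairs r₀₁ r₁₂ r₀₂ (suc zero)       (suc zero)       (s≤s ())
on-pairs r₀₁ r₁₂ r₀₂ (suc (suc zero)) (suc zero)       (s≤s ())
on-pairs r₀₁ r₁₂ r₀₂ (suc (suc zero)) (suc (suc zero)) (s≤s (s≤s ()))

lookup-123 : ∀ j → lookup pattern123 j ≡ j
lookup-123 zero             = refl
lookup-123 (suc zero)       = refl
lookup-123 (suc (suc zero)) = refl

lookup-321 : ∀ j → lookup pattern321 j ≡ opposite j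
lookup-321 zero             = refl
lookup-321 (suc zero)       = refl
lookup-321 (suc (suc zero)) = refl

-- For injective `τ` one direction suffices: by trichotomy, a failure of `τ j < τ j′` means equal
-- indices or the reverse order, and either contradicts `a j < a j′`.
order-iso : ∀ {o} (τ : Fin m → Fin n) (a : Fin m → Fin o) → (∀ {j j′} → toℕ (τ j) ≡ toℕ (τ j′) → j ≡ j′) →
            (∀ j j′ → τ j Fin.< τ j′ → a j Fin.< a j′) → ∀ j j′ → a j Fin.< a j′ ⇔ τ j Fin.< τ j′
order-iso τ a inj mono j j′ = mk⇔ reflects (mono j j′)
  where
  reflects : a j Fin.< a j′ → τ j Fin.< τ j′
  reflects aj<aj′ with ℕₚ.<-cmp (toℕ (τ j)) (toℕ (τ j′))
  ... | tri< τj<τj′ _ _ = τj<τj′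
  ... | tri≈ _ τj≡τj′ _ = contradiction aj<aj′ (<-irrefl (cong (toℕ ∘ a) (inj τj≡τj′)))
  ... | tri> _ _ τj′<τj = contradiction aj<aj′ (<-asym (mono j′ j τj′<τj))

opposite-cancel-< : {i j : Fin n} → opposite i Fin.< opposite j → j Fin.< i
opposite-cancel-< {n} {i} {j} lt = s≤s⁻¹ (∸-cancelʳ-< {suc (toℕ i)} {suc (toℕ j)} {n}
  (subst₂ _<_ (Finₚ.opposite-prop i) (Finₚ.opposite-prop j) lt))

contains123 : (σ : Word n) {i j k : Fin n} → i Fin.< j → j Fin.< k →
              lookup σ i Fin.< lookup σ j → lookup σ j Fin.< lookup σ k → Contains pattern123 σ
contains123 {n} σ {i} {j} {k} i<j j<k σi<σj σj<σk = is , on-pairs i<j j<k (<-trans i<j j<k) ,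
  order-iso (lookup pattern123) (λ j → lookup σ (lookup is j))
    (λ {a} {b} eq → trans (sym (lookup-123 a)) (trans (Finₚ.toℕ-injective eq) (lookup-123 b)))
    (λ a b a<b → on-pairs {λ a b → lookup σ (lookup is a) Fin.< lookup σ (lookup is b)}
      σi<σj σj<σk (<-trans σi<σj σj<σk) a b (subst₂ Fin._<_ (lookup-123 a) (lookup-123 b) a<b))
  where
  is : Vec (Fin n) 3
  is = i ∷ j ∷ k ∷ []

contains321 : (σ : Word n) {i j k : Fin n} → i Fin.< j → j Fin.< k →
              lookup σ j Fin.< lookup σ i → lookup σ k Fin.< lookup σ j → Contains pattern321 σ
contains321 {n} σ {i} {j} {k} i<j j<k σj<σi σk<σj = is , on-pairs i<j j<k (<-trans i<j j<k) ,
  order-iso (lookup pattern321) (λ j → lookup σ (lookup is j))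
    (λ {a} {b} eq → trans (sym (Finₚ.opposite-involutive a)) (trans
      (cong opposite (trans (sym (lookup-321 a)) (trans (Finₚ.toℕ-injective eq) (lookup-321 b))))
      (Finₚ.opposite-involutive b)))
    -- The pattern 321 is `opposite`, so an inequality between its values is the reverse inequality
    -- between positions; the relation is therefore flipped.
    (λ a b a<b → on-pairs {λ b a → lookup σ (lookup is a) Fin.< lookup σ (lookup is b)}
      σj<σi σk<σj (<-trans σk<σj σj<σi) b a
      (opposite-cancel-< (subst₂ Fin._<_ (lookup-321 a) (lookup-321 b) a<b)))
  where
  is : Vec (Fin n) 3
  is = i ∷ j ∷ k ∷ []

avoids⇒avoids123 : (σ : Word n) → Avoids pattern123 σ → Avoids123 (code σ)
avoids⇒avoids123 σ av x y z xyz⊆ x<y y<z with code-⊆⁻ σ xyz⊆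
... | i ∷ j ∷ k ∷ [] , (i<j ∷ _) ∷ (j<k ∷ _) ∷ _ , refl = av (contains123 σ i<j j<k x<y y<z)

avoids123⇒avoids : (σ : Word n) → Avoids123 (code σ) → Avoids pattern123 σ
avoids123⇒avoids σ av (is , inc , iso) = av _ _ _
  (code-⊆₃ σ (inc zero (suc zero) (s≤s z≤n)) (inc (suc zero) (suc (suc zero)) (s≤s (s≤s z≤n))))
  (Equivalence.from (iso zero (suc zero)) (s≤s z≤n))
  (Equivalence.from (iso (suc zero) (suc (suc zero))) (s≤s (s≤s z≤n)))

avoids⇒avoids123-reverse : (σ : Word n) → Avoids pattern321 σ → Avoids123 (reverse (code σ))
avoids⇒avoids123-reverse σ av x y z xyz⊆ x<y y<z
  with code-⊆⁻ σ (subst (z ∷ y ∷ x ∷ [] ⊆_) (Listₚ.reverse-involutive (code σ)) (Subₚ.reverse⁺ xyz⊆))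
... | i ∷ j ∷ k ∷ [] , (i<j ∷ _) ∷ (j<k ∷ _) ∷ _ , refl = av (contains321 σ i<j j<k y<z x<y)

avoids123-reverse⇒avoids : (σ : Word n) → Avoids123 (reverse (code σ)) → Avoids pattern321 σ
avoids123-reverse⇒avoids σ av (is , inc , iso) = av _ _ _
  (Subₚ.reverse⁺ (code-⊆₃ σ (inc zero (suc zero) (s≤s z≤n)) (inc (suc zero) (suc (suc zero)) (s≤s (s≤s z≤n)))))
  (Equivalence.from (iso (suc (suc zero)) (suc zero)) (s≤s z≤n))
  (Equivalence.from (iso (suc zero) zero) (s≤s (s≤s z≤n)))

-- Windows of positions and blocks of values

∈-window⁺ : (v : Vec (Fin n) m) (a l : ℕ) (i : Fin m) → a ≤ toℕ i → toℕ i < a + l →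
            toℕ (lookup v i) ∈ take l (drop a (code v))
∈-window⁺ (_ ∷ v) zero    (suc l) zero    _   _   = here refl
∈-window⁺ (_ ∷ v) zero    (suc l) (suc i) _   i<  = there (∈-window⁺ v 0 l i z≤n (s≤s⁻¹ i<))
∈-window⁺ (_ ∷ v) (suc a) l       (suc i) a≤i i<  = ∈-window⁺ v a l i (s≤s⁻¹ a≤i) (s≤s⁻¹ i<)

∈-window⁻ : ∀ {x} (v : Vec (Fin n) m) (a l : ℕ) → x ∈ take l (drop a (code v)) →
            ∃ λ i → (a ≤ toℕ i × toℕ i < a + l) × toℕ (lookup v i) ≡ x
∈-window⁻ []      zero    (suc l) ()
∈-window⁻ []      (suc a) (suc l) ()
∈-window⁻ (_ ∷ v) zero    (suc l) (here refl) = zero , (z≤n , s≤s z≤n) , refl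
∈-window⁻ (_ ∷ v) zero    (suc l) (there x∈)  = let i , (_ , i<) , eq = ∈-window⁻ v 0 l x∈ in suc i , (z≤n , s≤s i<) , eq
∈-window⁻ (_ ∷ v) (suc a) l       x∈          = let i , (a≤ , i<) , eq = ∈-window⁻ v a l x∈ in suc i , (s≤s a≤ , s≤s i<) , eq

take-drop-middle : (u c v : List A) → take (length c) (drop (length u) (u ++ c ++ v)) ≡ c
take-drop-middle []      []      v = refl
take-drop-middle []      (x ∷ c) v = cong (x ∷_) (take-drop-middle [] c v)
take-drop-middle (_ ∷ u) c       v = take-drop-middle u c v

-- `Clustered` compares subsets of `Fin n`, `HasBlock` sets of natural numbers. The bound
-- `κ + l ≤ n` turns every value of the block into an element of `Fin n`.
clustered⇒hasBlock : ∀ {κ l} (σ : Word n) → κ + l ≤ n → Clustered l (suc κ) σ → HasBlock κ l (code σ)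
clustered⇒hasBlock {n} {κ} {l} σ κ+l≤n (a , _ , block⊆ , window⊆) =
    take p w , take l (drop p w) , drop l (drop p w) ,
    trans (sym (Listₚ.take++drop≡id p w)) (cong (take p w ++_) (sym (Listₚ.take++drop≡id l (drop p w)))) ,
    λ x → mk⇔ to from
  where
  p = toℕ a
  w = code σ
  to : ∀ {x} → x ∈ take l (drop p w) → InBlock κ l x
  to x∈ with ∈-window⁻ σ p l x∈
  ... | i , (p≤i , i<) , refl = let κ≤ , <κ+l = window⊆ (i , (s≤s p≤i , s≤s i<) , refl) in s≤s⁻¹ κ≤ , s≤s⁻¹ <κ+l
  from : ∀ {x} → InBlock κ l x → x ∈ take l (drop p w)
  from {x} (κ≤x , x<κ+l) with block⊆ {fromℕ< x<n} (s≤s (subst (κ ≤_) (sym x≡) κ≤x) , s≤s (subst (_< κ + l) (sym x≡) x<κ+l))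
    where
    x<n = <-≤-trans x<κ+l κ+l≤n
    x≡ = Finₚ.toℕ-fromℕ< x<n
  ... | i , (p≤i , i<) , eq = subst (_∈ take l (drop p w)) (trans (cong toℕ eq) (Finₚ.toℕ-fromℕ< (<-≤-trans x<κ+l κ+l≤n)))
    (∈-window⁺ σ p l i (s≤s⁻¹ p≤i) (s≤s⁻¹ i<))

-- The window starts at position `length u`. It has the right length because `c` enumerates `l`
-- values, and `1 ≤ l` makes the start an element of `Fin n`.
hasBlock⇒clustered : ∀ {κ l} (σ : Word n) → IsPerm n (code σ) → 1 ≤ l → HasBlock κ l (code σ) → Clustered l (suc κ) σ
hasBlock⇒clustered {n} {κ} {l} σ perm 1≤l (u , c , v , eq , iff) =
    fromℕ< u<n , subst (λ p → suc p + l ≤ suc n) (sym p≡) (s≤s u+l≤n) ,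
    (λ x∈ → block⊆ x∈) , (λ x∈ → window⊆ x∈)
  where
  c-unique : Unique c
  c-unique = proj₁ (unique-++⁻ c (proj₁ (proj₂ (unique-++⁻ u (subst Unique eq (unique perm))))))
  length-c : length c ≡ l
  length-c = trans (enum-length
      (record { unique = c-unique ; sound = Equivalence.to (iff _) ; complete = Equivalence.from (iff _) })
      (enum-shift⁺ κ (downFrom-enum l)))
    (trans (Listₚ.length-map (_+ κ) (downFrom l)) (Listₚ.length-downFrom l))
  u+l≤n : length u + l ≤ n
  u+l≤n = begin
    length u + l                         ≡⟨ cong (length u +_) (sym length-c) ⟩
    length u + length c                  ≤⟨ +-monoʳ-≤ (length u) (m≤m+n (length c) (length v)) ⟩
    length u + (length c + length v)     ≡⟨ cong (length u +_) (sym (Listₚ.length-++ c)) ⟩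
    length u + length (c ++ v)           ≡⟨ sym (Listₚ.length-++ u) ⟩
    length (u ++ c ++ v)                 ≡⟨ cong length (sym eq) ⟩
    length (code σ)                      ≡⟨ length-code σ ⟩
    n                                    ∎
    where open ≤-Reasoning
  u<n : length u < n
  u<n = <-≤-trans (m<m+n (length u) 1≤l) u+l≤n
  p = toℕ (fromℕ< u<n)
  p≡ : p ≡ length u
  p≡ = Finₚ.toℕ-fromℕ< u<n
  window≡c : take l (drop p (code σ)) ≡ c
  window≡c = trans (cong₂ (λ p w → take l (drop p w)) p≡ eq)
    (trans (cong (λ l → take l (drop (length u) (u ++ c ++ v))) (sym length-c)) (take-drop-middle u c v))
  block⊆ : ∀ {y} → Interval (suc κ) l y → Window σ (suc p) l y
  block⊆ {y} (κ≤ , <κ+l)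
    with ∈-window⁻ σ p l (subst (toℕ y ∈_) (sym window≡c) (Equivalence.from (iff (toℕ y)) (s≤s⁻¹ κ≤ , s≤s⁻¹ <κ+l)))
  ... | i , (p≤i , i<) , y≡ = i , (s≤s p≤i , s≤s i<) , Finₚ.toℕ-injective y≡
  window⊆ : ∀ {y} → Window σ (suc p) l y → Interval (suc κ) l y
  window⊆ (i , (p≤i , i<) , refl) =
    let κ≤ , <κ+l = Equivalence.to (iff _) (subst (_ ∈_) window≡c (∈-window⁺ σ p l i (s≤s⁻¹ p≤i) (s≤s⁻¹ i<))) in
    s≤s κ≤ , s≤s <κ+l

hasBlock-reverse : ∀ {κ l w} → HasBlock κ l w → HasBlock κ l (reverse w)
hasBlock-reverse (u , c , v , refl , iff) = reverse v , reverse c , reverse u ,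
  trans (Listₚ.reverse-++ u (c ++ v)) (trans (cong (_++ reverse u) (Listₚ.reverse-++ c v)) (Listₚ.++-assoc (reverse v) (reverse c) (reverse u))) ,
  λ x → mk⇔ (Equivalence.to (iff x) ∘ ∈-resp-↭ (↭-reverse c)) (∈-resp-↭ (↭-sym (↭-reverse c)) ∘ Equivalence.from (iff x))

hasBlock-reverse⁻ : ∀ {κ l} w → HasBlock κ l (reverse w) → HasBlock κ l w
hasBlock-reverse⁻ {κ} {l} w b = subst (HasBlock κ l) (Listₚ.reverse-involutive w) (hasBlock-reverse b)

vectors-enum : ∀ m n → Enumerates (λ _ → ⊤) (vectors m n)
vectors-enum m n = record { unique = vectors-unique m n ; sound = λ _ → tt ; complete = λ {v} _ → ∈-vectors v }
  where
  vectors-unique : ∀ m n → Unique (vectors m n)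
  vectors-unique zero    n = [] ∷ []
  vectors-unique (suc m) n = Uniqueₚ.cartesianProductWith⁺ Vec._∷_ (λ { refl → refl , refl })
    (Uniqueₚ.allFin⁺ n) (vectors-unique m n)

avoiders-enum : (τ : Word m) → ∀ n → Enumerates (λ σ → IsPermutation σ × Avoids τ σ) (avoiders τ n)
avoiders-enum τ n = enum-⇔ (λ ((_ , perm) , av) → perm , av) (λ (perm , av) → (tt , perm) , av)
  (enum-filter (avoids? τ) (enum-filter isPermutation? (vectors-enum n n)))

-- An encoding of the permutations avoiding τ by the lists avoiding 123; reversal turns 321 into 123.
record Encoding (τ : Word 3) (n : ℕ) : Set where
  field
    encode     : Word n → List ℕ
    injective  : ∀ {σ ρ} → encode σ ≡ encode ρ → σ ≡ ρ
    isPerm     : ∀ {σ} → IsPermutation σ → IsPerm n (encode σ)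
    preimage   : ∀ {w} → IsPerm n w → ∃ λ σ → IsPermutation σ × encode σ ≡ w
    avoids⁺    : ∀ {σ} → Avoids τ σ → Avoids123 (encode σ)
    avoids⁻    : ∀ {σ} → Avoids123 (encode σ) → Avoids τ σ
    hasBlock⁺  : ∀ {κ l σ} → κ + l ≤ n → Clustered l (suc κ) σ → HasBlock κ l (encode σ)
    hasBlock⁻  : ∀ {κ l σ} → IsPermutation σ → 1 ≤ l → HasBlock κ l (encode σ) → Clustered l (suc κ) σ

encoding-123 : ∀ n → Encoding pattern123 n
encoding-123 n = record
  { encode    = code
  ; injective = code-injective _ _
  ; isPerm    = isPermutation⇒isPerm _
  ; preimage  = isPerm-decode
  ; avoids⁺   = λ {σ} → avoids⇒avoids123 σ
  ; avoids⁻   = λ {σ} → avoids123⇒avoids σ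
  ; hasBlock⁺ = clustered⇒hasBlock _
  ; hasBlock⁻ = λ {_} {_} {σ} perm → hasBlock⇒clustered σ (isPermutation⇒isPerm σ perm)
  }

encoding-321 : ∀ n → Encoding pattern321 n
encoding-321 n = record
  { encode    = reverse ∘ code
  ; injective = code-injective _ _ ∘ Listₚ.reverse-injective
  ; isPerm    = λ {σ} perm → enum-↭ (↭-sym (↭-reverse (code σ))) (isPermutation⇒isPerm σ perm)
  ; preimage  = λ {w} perm → let σ , perm′ , eq = isPerm-decode (enum-↭ (↭-sym (↭-reverse w)) perm) in
      σ , perm′ , trans (cong reverse eq) (Listₚ.reverse-involutive w)
  ; avoids⁺   = λ {σ} → avoids⇒avoids123-reverse σ
  ; avoids⁻   = λ {σ} → avoids123-reverse⇒avoids σ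
  ; hasBlock⁺ = λ {_} {_} {σ} κ+l≤n → hasBlock-reverse ∘ clustered⇒hasBlock σ κ+l≤n
  ; hasBlock⁻ = λ {_} {_} {σ} perm 1≤l →
      hasBlock⇒clustered σ (isPermutation⇒isPerm σ perm) 1≤l ∘ hasBlock-reverse⁻ (code σ)
  }

encoding : ∀ {τ} → τ ≡ pattern123 ⊎ τ ≡ pattern321 → ∀ n → Encoding τ n
encoding (inj₁ refl) = encoding-123
encoding (inj₂ refl) = encoding-321

length-avoiders : ∀ {τ n} → Encoding τ n → length (avoiders τ n) ≡ Cat n
length-avoiders {τ} {n} E = begin
  length (avoiders τ n)                ≡⟨ sym (Listₚ.length-map encode (avoiders τ n)) ⟩
  length (map encode (avoiders τ n))   ≡⟨ enum-length (enum-image encode injective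
      (λ (perm , av) → isPerm perm , avoids⁺ av)
      (λ (perm , av) → let σ , perm′ , eq = preimage perm in σ , (perm′ , avoids⁻ (subst Avoids123 (sym eq) av)) , eq)
      (avoiders-enum τ n)) (avoiders123-enum n) ⟩
  length (avoiders123 n)               ≡⟨ length-avoiders123 n ⟩
  Cat n                                ∎
  where
  open ≡-Reasoning
  open Encoding E

length-clustered : ∀ {τ n} → Encoding τ n → ∀ κ m r → κ + suc m + r ≡ n →
  length (filter (clustered? (suc m) (suc κ)) (avoiders τ n)) ≡ Cat (κ + suc r) + Cat κ * (Cat (suc m) ∸ 1) * Cat r
length-clustered {τ} E κ m r refl = trans
    (sym (Listₚ.length-map encode (filter (clustered? (suc m) (suc κ)) (avoiders τ (κ + suc m + r)))))
    (Block.block-count κ m r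
    (enum-image encode injective
      (λ ((perm , av) , cl) → (isPerm perm , avoids⁺ av) , hasBlock⁺ (m≤m+n (κ + suc m) r) cl)
      (λ ((perm , av) , b) → let σ , perm′ , eq = preimage perm in
        σ , ((perm′ , avoids⁻ (subst Avoids123 (sym eq) av)) ,
             hasBlock⁻ perm′ (s≤s z≤n) (subst (HasBlock κ (suc m)) (sym eq) b)) , eq)
      (enum-filter (clustered? (suc m) (suc κ)) (avoiders-enum τ (κ + suc m + r)))))
  where open Encoding E

-- Asymptotics

length-clustered-at : ∀ {τ n k} → Encoding τ n → ∀ κ m r → k ≡ suc κ → κ + suc m + r ≡ n →
  length (filter (clustered? (suc m) k) (avoiders τ n)) ≡ Cat (κ + suc r) + Cat κ * (Cat (suc m) ∸ 1) * Cat r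
length-clustered-at E κ m r refl = length-clustered E κ m r

-- The index `κ + suc r` is n - m, the size of the contracted permutations, so m growth steps lead
-- from it to C_n.
Cat-shrink-bounds : ∀ m M κ r {n} → κ + suc m + r ≡ n → M ≤ r →
  Cat n ≤ 4 ^ m * Cat (κ + suc r) × M * (4 ^ m * Cat (κ + suc r)) ≤ (M + gap m) * Cat n
Cat-shrink-bounds m M κ r refl M≤r = subst
  (λ n → Cat n ≤ 4 ^ m * Cat (κ + suc r) × M * (4 ^ m * Cat (κ + suc r)) ≤ (M + gap m) * Cat n)
  (arith κ m r)
  (Cat-+-≤ m (κ + suc r) , Cat-+-≥ m (≤-trans M≤r (≤-trans (n≤1+n r) (m≤n+m (suc r) κ))))
  where
  arith : ∀ κ m r → m + (κ + suc r) ≡ κ + suc m + r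
  arith = solve-∀

-- Abstract in `p` and `q`, so that one estimate serves k and its mirror image. Times 4^e, the count
-- reads P (4^m C_{n-m}) + b (4^e C_{n-e}), and each bracket is C_n up to a relative error of order
-- 1/M.
fixed-⟶ : ∀ κ m (p q : ℕ → ℕ) (q≢0 : ∀ n → NonZero (q n)) → (∀ n → q n ≡ Cat n) →
  (∀ n r → κ + suc m + r ≡ n → p n ≡ Cat (κ + suc r) + Cat κ * (Cat (suc m) ∸ 1) * Cat r) →
  (λ n → (⁺ p n / q n) {{q≢0 n}}) ⟶
    1/4^ m +ℚ catalan κ *ℚ (catalan (suc m) -ℚ 1ℚ) *ℚ 1/4^ (κ + suc m)
fixed-⟶ κ m p q q≢0 q≡ p≡ = subst ((λ n → (⁺ p n / q n) {{q≢0 n}}) ⟶_)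
    (sym (limit-closed κ m e (+-suc κ m)))
    -- The error constant adds those of the two brackets, and n ≥ M + e gives r = n - e ≥ M.
    (ratio-⟶ p q q≢0 (P + b) (4 ^ e) {{m^n≢0 4 e}} (P * gap m + b * gap e)
      λ M → M + e , λ n M+e≤n → bounds M n (n ∸ e) (m+[n∸m]≡n (≤-trans (m≤n+m e M) M+e≤n)) (m+n≤o⇒m≤o∸n M M+e≤n))
  where
  e = κ + suc m
  P = 4 ^ suc κ
  R = 4 ^ m
  b = Cat κ * (Cat (suc m) ∸ 1)
  4^e≡ : 4 ^ e ≡ P * R
  4^e≡ = trans (cong (4 ^_) (+-suc κ m)) (^-distribˡ-+-* 4 (suc κ) m)

  bounds : ∀ M n r → e + r ≡ n → M ≤ r →
           (P + b) * q n ≤ 4 ^ e * p n × M * (4 ^ e * p n) ≤ (M * (P + b) + (P * gap m + b * gap e)) * q n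
  bounds M n r e+r≡n M≤r rewrite q≡ n | p≡ n r e+r≡n = lower , upper
    where
    open ≤-Reasoning
    X = Cat (κ + suc r)
    Y = Cat r
    Q = Cat n
    Q≤RX = proj₁ (Cat-shrink-bounds m M κ r e+r≡n M≤r)
    MRX≤ = proj₂ (Cat-shrink-bounds m M κ r e+r≡n M≤r)
    Q≤4^eY : Q ≤ 4 ^ e * Y
    Q≤4^eY = subst (λ n → Cat n ≤ 4 ^ e * Y) e+r≡n (Cat-+-≤ e r)
    M4^eY≤ : M * (4 ^ e * Y) ≤ (M + gap e) * Q
    M4^eY≤ = subst (λ n → M * (4 ^ e * Y) ≤ (M + gap e) * Cat n) e+r≡n (Cat-+-≥ e M≤r)
    split : 4 ^ e * (X + b * Y) ≡ P * (R * X) + b * (4 ^ e * Y)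
    split = trans (*-distribˡ-+ (4 ^ e) X (b * Y))
      (cong₂ _+_ (trans (cong (_* X) 4^e≡) (*-assoc P R X)) (swap (4 ^ e) b Y))
      where
      swap : ∀ a b c → a * (b * c) ≡ b * (a * c)
      swap = solve-∀
    lower : (P + b) * Q ≤ 4 ^ e * (X + b * Y)
    lower = begin
      (P + b) * Q                         ≡⟨ *-distribʳ-+ Q P b ⟩
      P * Q + b * Q                       ≤⟨ +-mono-≤ (*-monoʳ-≤ P Q≤RX) (*-monoʳ-≤ b Q≤4^eY) ⟩
      P * (R * X) + b * (4 ^ e * Y)       ≡⟨ sym split ⟩
      4 ^ e * (X + b * Y)                 ∎
    distribute : ∀ M P x b y → M * (P * x + b * y) ≡ P * (M * x) + b * (M * y)
    distribute = solve-∀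
    collect : ∀ M P g b h Q → P * ((M + g) * Q) + b * ((M + h) * Q) ≡ (M * (P + b) + (P * g + b * h)) * Q
    collect = solve-∀
    upper : M * (4 ^ e * (X + b * Y)) ≤ (M * (P + b) + (P * gap m + b * gap e)) * Q
    upper = begin
      M * (4 ^ e * (X + b * Y))                           ≡⟨ cong (M *_) split ⟩
      M * (P * (R * X) + b * (4 ^ e * Y))                 ≡⟨ distribute M P (R * X) b (4 ^ e * Y) ⟩
      P * (M * (R * X)) + b * (M * (4 ^ e * Y))           ≤⟨ +-mono-≤ (*-monoʳ-≤ P MRX≤) (*-monoʳ-≤ b M4^eY≤) ⟩
      P * ((M + gap m) * Q) + b * ((M + gap e) * Q)       ≡⟨ collect M P (gap m) b (gap e) Q ⟩
      (M * (P + b) + (P * gap m + b * gap e)) * Q         ∎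

moving-⟶ : ∀ m (p q : ℕ → ℕ) (q≢0 : ∀ n → NonZero (q n)) → (∀ n → q n ≡ Cat n) →
  (∀ M → ∃ λ N → ∀ n → N ≤ n → ∃₂ λ κ r → M ≤ κ × M ≤ r × κ + suc m + r ≡ n ×
    p n ≡ Cat (κ + suc r) + Cat κ * (Cat (suc m) ∸ 1) * Cat r) →
  (λ n → (⁺ p n / q n) {{q≢0 n}}) ⟶ 1/4^ m
moving-⟶ m p q q≢0 q≡ p≡ = ratio-⟶ p q q≢0 1 R {{m^n≢0 4 m}} (gap m + R * c)
    λ M → let N , h = p≡ M in N , λ n N≤n →
      let κ , r , M≤κ , M≤r , sum≡n , pn≡ = h n N≤n in bounds M n κ r M≤κ M≤r sum≡n pn≡
  where
  R = 4 ^ m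
  c = Cat (suc m) ∸ 1
  bounds : ∀ M n κ r → M ≤ κ → M ≤ r → κ + suc m + r ≡ n → p n ≡ Cat (κ + suc r) + Cat κ * c * Cat r →
           1 * q n ≤ R * p n × M * (R * p n) ≤ (M * 1 + (gap m + R * c)) * q n
  bounds M n κ r M≤κ M≤r sum≡n pn≡ rewrite q≡ n | pn≡ = lower , upper
    where
    open ≤-Reasoning
    X = Cat (κ + suc r)
    Q = Cat n
    Q≤RX = proj₁ (Cat-shrink-bounds m M κ r sum≡n M≤r)
    MRX≤ = proj₂ (Cat-shrink-bounds m M κ r sum≡n M≤r)
    -- Hence the second summand has no share in the limit: it only adds `R * c` to the error
    -- constant.
    small : M * (Cat κ * Cat r) ≤ Q
    small = ≤-trans (Cat-*-bound M≤κ M≤r) (Cat-mono (subst (suc (κ + r) ≤_) sum≡n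
      (subst (suc (κ + r) ≤_) (arith κ m r) (m≤m+n (suc (κ + r)) m))))
      where
      arith : ∀ κ m r → suc (κ + r) + m ≡ κ + suc m + r
      arith = solve-∀
    lower : 1 * Q ≤ R * (X + Cat κ * c * Cat r)
    lower = ≤-trans (≤-reflexive (*-identityˡ Q)) (≤-trans Q≤RX (*-monoʳ-≤ R (m≤m+n X _)))
    distribute : ∀ M R X a c b → M * (R * (X + a * c * b)) ≡ M * (R * X) + R * c * (M * (a * b))
    distribute = solve-∀
    collect : ∀ M g d Q → (M + g) * Q + d * Q ≡ (M * 1 + (g + d)) * Q
    collect = solve-∀
    upper : M * (R * (X + Cat κ * c * Cat r)) ≤ (M * 1 + (gap m + R * c)) * Q
    upper = begin
      M * (R * (X + Cat κ * c * Cat r))                 ≡⟨ distribute M R X (Cat κ) c (Cat r) ⟩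
      M * (R * X) + R * c * (M * (Cat κ * Cat r))       ≤⟨ +-mono-≤ MRX≤ (*-monoʳ-≤ (R * c) small) ⟩
      (M + gap m) * Q + R * c * Q                       ≡⟨ collect M (gap m) (R * c) Q ⟩
      (M * 1 + (gap m + R * c)) * Q                     ∎

Pav-fixed-⟶ : ∀ {τ : Word 3} → (∀ n → Encoding τ n) → ∀ κ m →
  (λ n → Pav {n = n} τ (clustered? (suc m) (suc κ))) ⟶
    1/4^ m +ℚ catalan κ *ℚ (catalan (suc m) -ℚ 1ℚ) *ℚ 1/4^ (κ + suc m)
Pav-fixed-⟶ {τ} E κ m = fixed-⟶ κ m
  (λ n → length (filter (clustered? (suc m) (suc κ)) (avoiders τ n)))
  (λ n → length (avoiders τ n)) (avoiders-nonZero τ) (λ n → length-avoiders (E n))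
  (λ n r → length-clustered-at (E n) κ m r refl)

Pav-fixed-mirror-⟶ : ∀ {τ : Word 3} → (∀ n → Encoding τ n) → ∀ κ m →
  (λ n → Pav {n = n} τ (clustered? (suc m) (n + 2 ∸ suc κ ∸ suc m))) ⟶
    1/4^ m +ℚ catalan κ *ℚ (catalan (suc m) -ℚ 1ℚ) *ℚ 1/4^ (κ + suc m)
Pav-fixed-mirror-⟶ {τ} E κ m = fixed-⟶ κ m
  (λ n → length (filter (clustered? (suc m) (n + 2 ∸ suc κ ∸ suc m)) (avoiders τ n)))
  (λ n → length (avoiders τ n)) (avoiders-nonZero τ) (λ n → length-avoiders (E n))
  (λ n r sum≡n → trans
    (length-clustered-at (E n) r m κ (mirror r sum≡n) (trans (reflect r m κ) sum≡n))
    (cong₂ _+_ (cong Cat (reflect′ r κ)) (swap (Cat r) (Cat (suc m) ∸ 1) (Cat κ))))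
  where
  reflect : ∀ r m κ → r + suc m + κ ≡ κ + suc m + r
  reflect = solve-∀
  reflect′ : ∀ r κ → r + suc κ ≡ κ + suc r
  reflect′ = solve-∀
  swap : ∀ a b c → a * b * c ≡ c * b * a
  swap = solve-∀
  arith : ∀ κ m r → κ + suc m + r + 2 ≡ suc κ + (suc m + suc r)
  arith = solve-∀
  -- The mirror image of k exchanges the κ values below the block with the r values above it.
  mirror : ∀ {n} r → κ + suc m + r ≡ n → n + 2 ∸ suc κ ∸ suc m ≡ suc r
  mirror r refl = trans (cong (λ z → z ∸ suc κ ∸ suc m) (arith κ m r))
    (trans (cong (_∸ suc m) (m+n∸m≡n (suc κ) (suc m + suc r))) (m+n∸m≡n (suc m) (suc r)))

block-split : ∀ M m {n k} → k ≤ n ∸ suc m + 1 → suc m < n → M < k → M + suc m ≤ n ∸ k →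
  ∃₂ λ κ r → M ≤ κ × M ≤ r × k ≡ suc κ × κ + suc m + r ≡ n
block-split M m {n} {suc κ} k≤ l<n M<k M+l≤n-k = κ , r , s≤s⁻¹ M<k , M≤r , refl , sum≡n
  where
  r = n ∸ suc m ∸ κ
  κ≤n-l : κ ≤ n ∸ suc m
  κ≤n-l = s≤s⁻¹ (subst (suc κ ≤_) (+-comm (n ∸ suc m) 1) k≤)
  shuffle : ∀ κ m r → κ + suc m + r ≡ suc m + (κ + r)
  shuffle = solve-∀
  shuffle′ : ∀ κ m r → κ + suc m + r ≡ suc κ + (m + r)
  shuffle′ = solve-∀
  sum≡n : κ + suc m + r ≡ n
  sum≡n = trans (shuffle κ m r) (trans (cong (suc m +_) (m+[n∸m]≡n κ≤n-l)) (m+[n∸m]≡n (<⇒≤ l<n)))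
  -- Since k is the least value of the block, n - k counts the other m block values together with
  -- the r values above; this is why the threshold for n - k exceeds M by the block length.
  n-k≡ : n ∸ suc κ ≡ m + r
  n-k≡ = trans (cong (_∸ suc κ) (trans (sym sum≡n) (shuffle′ κ m r))) (m+n∸m≡n (suc κ) (m + r))
  M≤r : M ≤ r
  M≤r = +-cancelˡ-≤ m M r (begin
    m + M        ≤⟨ n≤1+n (m + M) ⟩
    suc m + M    ≡⟨ +-comm (suc m) M ⟩
    M + suc m    ≤⟨ M+l≤n-k ⟩
    n ∸ suc κ    ≡⟨ n-k≡ ⟩
    m + r        ∎)
    where open ≤-Reasoning

Pav-moving-⟶ : ∀ {τ : Word 3} → (∀ n → Encoding τ n) → ∀ m (k : ℕ → ℕ) →
  (∀ n → suc m < n → 1 ≤ k n × k n ≤ n ∸ suc m + 1) → k ⟶∞ → (λ n → n ∸ k n) ⟶∞ →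
  (λ n → Pav {n = n} τ (clustered? (suc m) (k n))) ⟶ 1/4^ m
Pav-moving-⟶ {τ} E m k k-range k→∞ n-k→∞ = moving-⟶ m
    (λ n → length (filter (clustered? (suc m) (k n)) (avoiders τ n)))
    (λ n → length (avoiders τ n)) (avoiders-nonZero τ) (λ n → length-avoiders (E n)) eventually
  where
  eventually : ∀ M → ∃ λ N → ∀ n → N ≤ n → ∃₂ λ κ r → M ≤ κ × M ≤ r × κ + suc m + r ≡ n ×
    length (filter (clustered? (suc m) (k n)) (avoiders τ n)) ≡ Cat (κ + suc r) + Cat κ * (Cat (suc m) ∸ 1) * Cat r
  eventually M =
    let N₁ , h₁ = k→∞ (suc M)
        N₂ , h₂ = n-k→∞ (M + suc m) in
    2 + m + N₁ + N₂ , λ n N≤n →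
      let N₁₂≤n = ≤-trans (m≤m+n (2 + m + N₁) N₂) N≤n
          l<n   = ≤-trans (m≤m+n (2 + m) N₁) N₁₂≤n
          κ , r , M≤κ , M≤r , k≡ , sum≡n = block-split M m (proj₂ (k-range n l<n)) l<n
            (h₁ n (≤-trans (m≤n+m N₁ (2 + m)) N₁₂≤n)) (h₂ n (≤-trans (m≤n+m N₂ (2 + m + N₁)) N≤n))
      in κ , r , M≤κ , M≤r , sum≡n , length-clustered-at (E n) κ m r k≡ sum≡n

corollary3 : (τ : Word 3) → τ ≡ pattern123 ⊎ τ ≡ pattern321 →
    (l : ℕ) → 2 ≤ l →
    ( (k : ℕ) → 1 ≤ k →
        let limit = 1/4^ (l ∸ 1) +ℚ catalan (k ∸ 1) *ℚ (catalan l -ℚ 1ℚ) *ℚ 1/4^ (k + l ∸ 1) in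
        ((λ n → Pav {n = n} τ (clustered? l k)) ⟶ limit) ×
        ((λ n → Pav {n = n} τ (clustered? l (n + 2 ∸ k ∸ l))) ⟶ limit) )
    ×
    ( (k : ℕ → ℕ) → (∀ n → l < n → 1 ≤ k n × k n ≤ n ∸ l + 1) →
        k ⟶∞ → (λ n → n ∸ k n) ⟶∞ →
        (λ n → Pav {n = n} τ (clustered? l (k n))) ⟶ 1/4^ (l ∸ 1) )
-- With l = m + 1 and k = κ + 1 the truncated subtractions in the limit compute away.
corollary3 τ τ∈ (suc m) _ =
  (λ { (suc κ) _ → Pav-fixed-⟶ (encoding τ∈) κ m , Pav-fixed-mirror-⟶ (encoding τ∈) κ m }) ,
  Pav-moving-⟶ (encoding τ∈) m
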